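{- For all integers $\alpha\ge 0$ and $n\ge 0$, \[ \overline{p}_3(7\cdot 4^{\alpha+1}n)\equiv (-1)^n\,\overline{p}_3(7n)\pmod 7 \quad\text{and}\quad \overline{p}_3\big(4^{\alpha}(56n+49)\big)\equiv 0\pmod 7. \]
   Context: An overpartition of $n$ is a partition of $n$ in which the first occurrence of each distinct part may (or may not) be overlined. An overpartition triple of $n$ is a triple of overpartitions whose parts together sum to $n$. $\overline{p}_3(n)$ denotes the number of overpartition triples of $n$, with $\overline{p}_3(0)=1$; equivalently $\sum_{n\ge0}\overline{p}_3(n)q^n=\big((-q;q)_\infty/(q;q)_\infty\big)^3$, where $(a;q)_\infty=\prod_{n\ge0}(1-aq^n)$. -}

module Defs where

open import Data.Nat using (ℕ; zero; suc; _+_; _*_; _∸_; _^_; _≤ᵇ_)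
open import Data.Bool using (if_then_else_)

-- Number of ways to choose the multiplicity block of the part j (j ≥ 1)
-- in an overpartition: part j occurs m ≥ 1 times, and its first occurrence
-- is overlined or not (2 choices).  Helper: sum over m = 1 .. fuel with
-- m * j ≤ n of  f (n ∸ m * j).
sumMult : (j : ℕ) → (f : ℕ → ℕ) → (n fuel : ℕ) → ℕ
sumMult j f n zero = 0
sumMult j f n (suc m) =
  sumMult j f n m + (if suc m * j ≤ᵇ n then f (n ∸ suc m * j) else 0)

-- opBounded k n = number of overpartitions of n all of whose parts are ≤ k.
opBounded : ℕ → ℕ → ℕ
opBounded zero zero = 1
opBounded zero (suc n) = 0
opBounded (suc k) n = opBounded k n + 2 * sumMult (suc k) (opBounded k) n n

pbar : ℕ → ℕ
pbar n = opBounded n n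

pbar2 : ℕ → ℕ
pbar2 n = go n
  where
  go : ℕ → ℕ
  go zero = pbar 0 * pbar n
  go (suc a) = go a + pbar (suc a) * pbar (n ∸ suc a)

pbar3 : ℕ → ℕ
pbar3 n = go n
  where
  go : ℕ → ℕ
  go zero = pbar 0 * pbar2 n
  go (suc a) = go a + pbar (suc a) * pbar2 (n ∸ suc a)

-- Since ∑ p̄(n) qⁿ is the inverse of φ(-q) = ∑ (-1)ˢ q^(s²) (Gauss), ∑ p̄₃(n) qⁿ = φ(-q)⁴ / φ(-q)⁷, and modulo 7
-- the denominator is φ(-q⁷). Taking every seventh coefficient therefore gives p̄₃(7n) ≡ (-1)ⁿ r₃(n) as soon as
-- r₄(7n) ≡ r₄(n) modulo 7, where r_k counts the representations by k squares. The theorem then follows from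
-- r₃(4n) = r₃(n) and r₃(8n+7) = 0.
--
-- Gauss' identity is the limit of ∑ (-1)ʲ q^(j²) / ((q)_{n-j} (q)_{n+j}) = 1 / ((q)_n (-q)_n), which telescopes.
--
-- For r₄(7n) ≡ r₄(n), count pairs of a quaternion x of norm 7n and one of the eight π = 2 ± i ± j ± k such that
-- x = yπ. For each π there are r₄(n) such x, and each x occurs once or, if 7 divides x, eight times.
module Submission where

open import Algebra.Bundles using (CommutativeRing)
import Algebra.Solver.Ring
open import Algebra.Solver.Ring.AlmostCommutativeRing using (fromCommutativeRing; _-Raw-AlmostCommutative⟶_)
open import Data.Bool using (true; false; T)
open import Data.Fin using (Fin; toℕ; fromℕ<)
open import Data.Fin.Properties using (all?; toℕ-fromℕ<)
open import Data.Integer as ℤ using (ℤ; +_; -[1+_])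
open import Data.Integer.DivMod using (_%ℕ_; _/ℕ_; n%ℕd<d; a≡a%ℕn+[a/ℕn]*n)
import Data.Integer.Divisibility.Signed as ℤ
open import Data.Integer.Divisibility.Signed using (divides; ∣m∣n⇒∣m+n; ∣m⇒∣-m; ∣n⇒∣m*n; ∣m⇒∣m*n; ∣⇒∣ᵤ; ∣ᵤ⇒∣)
import Data.Integer.Properties as ℤ
open import Data.Integer.Solver renaming (module +-*-Solver to ℤS)
open import Data.List using (List; []; _∷_; _++_; length; filter; map; cartesianProduct)
open import Data.List.Membership.Propositional using (_∈_)
open import Data.List.Membership.Propositional.Properties using
  (∈-++⁺ˡ; ∈-++⁺ʳ; ∈-++⁻; ∈-cartesianProduct⁺; ∈-cartesianProduct⁻; ∈-filter⁺; ∈-filter⁻; ∈-map⁺; ∈-map⁻)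
open import Data.List.Membership.Propositional.Properties.WithK using (unique∧set⇒bag)
import Data.List.Properties as List
open import Data.List.Relation.Binary.BagAndSetEquality using (∼bag⇒↭)
open import Data.List.Relation.Binary.Permutation.Propositional.Properties using (↭-length)
open import Data.List.Relation.Unary.All as All using (All; []; _∷_)
open import Data.List.Relation.Unary.AllPairs using ([]; _∷_)
open import Data.List.Relation.Unary.Any using (here; there)
open import Data.List.Relation.Unary.Unique.Propositional using (Unique)
import Data.List.Relation.Unary.Unique.Propositional.Properties as Unique
import Data.Maybe as Maybe
open import Data.Nat as ℕ using (ℕ; zero; suc; _≤_; _<_; z≤n; s≤s; _∸_; _≤ᵇ_; NonZero)
import Data.Nat.DivMod as ℕ
import Data.Nat.Divisibility as ℕ
open import Data.Nat.ListAction using (sum)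
import Data.Nat.Properties as ℕ
open import Algebra.Properties.CommutativeSemigroup ℕ.+-commutativeSemigroup using (x∙yz≈y∙xz)
open import Data.Nat.Solver renaming (module +-*-Solver to ℕS)
open import Data.Product using (∃; ∃₂; _×_; _,_; proj₁; proj₂)
open import Data.Sum using (inj₁; inj₂)
open import Defs
open import Function using (_∘_; mk⇔)
open import Level using (0ℓ)
open import Relation.Binary.Bundles using (Setoid)
open import Relation.Binary.Consequences using (dec⇒weaklyDec)
open import Relation.Binary.Definitions using (Decidable; WeaklyDecidable)
open import Relation.Binary.PropositionalEquality hiding (setoid)
open import Relation.Nullary using (Dec; yes; no; ¬?; _×-dec_; _→-dec_; contradiction)
open import Relation.Nullary.Decidable using (toWitness)

-- The congruence r₄(7n) ≡ r₄(n) comes down to a finite computation. As `conj π · π` is 7, whether x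
-- is a left multiple of π depends only on x modulo 7, so the number of suitable π can be evaluated
-- on residues.
--
-- The signs are harmless: s² and s have the same parity, so φ(-q)^k has the coefficients (-1)ⁿ
-- r_k(n), and (-1)^(7n) = (-1)ⁿ because 7 is odd.
--
-- Infinite products and sums enter only through truncations. Coefficient m is final from the m-th
-- truncation on, so Gauss' identity is proved modulo q^(n+1) for each n and then read along the
-- diagonal. The factors 1 / (q)_n are introduced as generating functions of partitions with parts
-- at most n, with (1 - qⁿ) cleared from every recurrence, so that no series has to be inverted.
--
-- Each r_k(n) is the length of a duplicate-free list, and these lists are built by the recursion
-- that defines the product of series. Products of series thereby count tuples, and equalities of
-- counts come from bijections between such lists.

module PowerSeries where

  -- The ring of formal power series over the integers

  open ℤS using () renaming (solve to ℤ-solve; _:=_ to _:≡_; _:+_ to _⟨+⟩_; _:*_ to _⟨*⟩_)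

  Series : Set
  Series = ℕ → ℤ

  infix 4 _≈_
  record _≈_ (f g : Series) : Set where
    constructor pointwise
    field at : ∀ n → f n ≡ g n
  open _≈_ public

  infixl 6 _⊕_
  infixl 7 _⊛_
  infix 8 ⊖_

  -- Opaque: otherwise the unifier unfolds f ⊕ g ≈ h coefficientwise and can no longer recover f and g.
  opaque
    _⊕_ : Series → Series → Series
    (f ⊕ g) n = f n ℤ.+ g n

    ⊖_ : Series → Series
    (⊖ f) n = ℤ.- f n

    ⊕-at : ∀ f g n → (f ⊕ g) n ≡ f n ℤ.+ g n
    ⊕-at f g n = refl

  -- The Cauchy product, unrolled along `f` = `f 0` + X · (`f ∘ suc`). Identities can then be proved
  -- by induction on the index with `f` generalised.
  _⊛_ : Series → Series → Series
  (f ⊛ g) zero = f 0 ℤ.* g 0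
  (f ⊛ g) (suc n) = f 0 ℤ.* g (suc n) ℤ.+ (f ∘ suc ⊛ g) n

  const : ℤ → Series
  const a zero = a
  const a (suc n) = + 0

  X·_ : Series → Series
  (X· f) zero = + 0
  (X· f) (suc n) = f n

  X^ : ℕ → Series
  X^ zero = const (+ 1)
  X^ (suc k) = X· X^ k

  ≈-refl : ∀ {f} → f ≈ f
  ≈-refl = pointwise λ _ → refl

  ≡⇒≈ : ∀ {f g} → f ≡ g → f ≈ g
  ≡⇒≈ refl = ≈-refl

  ≈-sym : ∀ {f g} → f ≈ g → g ≈ f
  ≈-sym p = pointwise λ n → sym (at p n)

  ≈-trans : ∀ {f g h} → f ≈ g → g ≈ h → f ≈ h
  ≈-trans p q = pointwise λ n → trans (at p n) (at q n)

  -- A coefficient of a product sees only coefficients of at most its own index. This is what lets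
  -- identities between truncations pass to the limit.
  ⊛-local : ∀ {f f′ g g′} n → (∀ m → m ℕ.≤ n → f m ≡ f′ m) → (∀ m → m ℕ.≤ n → g m ≡ g′ m) → (f ⊛ g) n ≡ (f′ ⊛ g′) n
  ⊛-local zero p q = cong₂ ℤ._*_ (p 0 z≤n) (q 0 z≤n)
  ⊛-local (suc n) p q = cong₂ ℤ._+_ (cong₂ ℤ._*_ (p 0 z≤n) (q (suc n) ℕ.≤-refl))
    (⊛-local n (λ m m≤n → p (suc m) (s≤s m≤n)) (λ m m≤n → q m (ℕ.m≤n⇒m≤1+n m≤n)))

  ⊛-cong : ∀ {f f′ g g′} → f ≈ f′ → g ≈ g′ → f ⊛ g ≈ f′ ⊛ g′
  ⊛-cong p q = pointwise λ n → ⊛-local n (λ m _ → at p m) (λ m _ → at q m)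

  zero-⊛ : ∀ g n → ((λ _ → + 0) ⊛ g) n ≡ + 0
  zero-⊛ g zero = ℤ.*-zeroˡ (g 0)
  zero-⊛ g (suc n) = cong₂ ℤ._+_ (ℤ.*-zeroˡ (g (suc n))) (zero-⊛ g n)

  const-⊛ : ∀ a g n → (const a ⊛ g) n ≡ a ℤ.* g n
  const-⊛ a g zero = refl
  const-⊛ a g (suc n) = trans (cong (λ z → a ℤ.* g (suc n) ℤ.+ z) (zero-⊛ g n)) (ℤ.+-identityʳ _)

  X·-⊛ : ∀ f g → (X· f) ⊛ g ≈ X· (f ⊛ g)
  X·-⊛ f g = pointwise λ { zero → ℤ.*-zeroˡ (g 0) ; (suc n) → trans (cong (ℤ._+ (f ⊛ g) n) (ℤ.*-zeroˡ (g (suc n))))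
    (ℤ.+-identityˡ _) }

  ⊛-scale : ∀ a g h n → ((λ m → a ℤ.* g m) ⊛ h) n ≡ a ℤ.* (g ⊛ h) n
  ⊛-scale a g h zero = ℤ.*-assoc a (g 0) (h 0)
  ⊛-scale a g h (suc n) rewrite ⊛-scale a (g ∘ suc) h n =
    ℤ-solve 4 (λ a b c d → a ⟨*⟩ b ⟨*⟩ c ⟨+⟩ a ⟨*⟩ d :≡ a ⟨*⟩ (b ⟨*⟩ c ⟨+⟩ d)) refl a (g 0) (h (suc n)) _

  opaque
    unfolding _⊕_ ⊖_

    ⊕-cong : ∀ {f f′ g g′} → f ≈ f′ → g ≈ g′ → f ⊕ g ≈ f′ ⊕ g′
    ⊕-cong p q = pointwise λ n → cong₂ ℤ._+_ (at p n) (at q n)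

    ⊖-cong : ∀ {f f′} → f ≈ f′ → ⊖ f ≈ ⊖ f′
    ⊖-cong p = pointwise λ n → cong ℤ.-_ (at p n)

    ⊕-assoc : ∀ f g h → f ⊕ g ⊕ h ≈ f ⊕ (g ⊕ h)
    ⊕-assoc f g h = pointwise λ n → ℤ.+-assoc (f n) (g n) (h n)

    ⊕-comm : ∀ f g → f ⊕ g ≈ g ⊕ f
    ⊕-comm f g = pointwise λ n → ℤ.+-comm (f n) (g n)

    ⊕-identityˡ : ∀ f → const (+ 0) ⊕ f ≈ f
    ⊕-identityˡ f = pointwise λ { zero → ℤ.+-identityˡ (f 0) ; (suc n) → ℤ.+-identityˡ (f (suc n)) }

    ⊕-inverseˡ : ∀ f → ⊖ f ⊕ f ≈ const (+ 0)
    ⊕-inverseˡ f = pointwise λ { zero → ℤ.+-inverseˡ (f 0) ; (suc n) → ℤ.+-inverseˡ (f (suc n)) }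

    const-⊕ : ∀ a b → const (a ℤ.+ b) ≈ const a ⊕ const b
    const-⊕ a b = pointwise λ { zero → refl ; (suc n) → refl }

    const-⊖ : ∀ a → const (ℤ.- a) ≈ ⊖ const a
    const-⊖ a = pointwise λ { zero → refl ; (suc n) → refl }

    ⊛-distribʳ : ∀ h f g n → ((f ⊕ g) ⊛ h) n ≡ (f ⊛ h ⊕ g ⊛ h) n
    ⊛-distribʳ h f g zero = ℤ.*-distribʳ-+ (h 0) (f 0) (g 0)
    ⊛-distribʳ h f g (suc n) rewrite ⊛-distribʳ h (f ∘ suc) (g ∘ suc) n =
      ℤ-solve 5 (λ a b c d e → (a ⟨+⟩ b) ⟨*⟩ c ⟨+⟩ (d ⟨+⟩ e) :≡ a ⟨*⟩ c ⟨+⟩ d ⟨+⟩ (b ⟨*⟩ c ⟨+⟩ e)) refl (f 0) (g 0)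
        (h (suc n)) _ _

    ⊛-assoc : ∀ f g h n → ((f ⊛ g) ⊛ h) n ≡ (f ⊛ (g ⊛ h)) n
    ⊛-assoc f g h zero = ℤ.*-assoc (f 0) (g 0) (h 0)
    ⊛-assoc f g h (suc n)
      rewrite ⊛-distribʳ h (λ m → f 0 ℤ.* g (suc m)) (f ∘ suc ⊛ g) n
            | ⊛-scale (f 0) (g ∘ suc) h n
            | ⊛-assoc (f ∘ suc) g h n =
      ℤ-solve 5 (λ a b c d e → a ⟨*⟩ b ⟨*⟩ c ⟨+⟩ (a ⟨*⟩ d ⟨+⟩ e) :≡ a ⟨*⟩ (b ⟨*⟩ c ⟨+⟩ d) ⟨+⟩ e) refl (f 0) (g 0)
        (h (suc n)) _ _

  -- The mirror image of the defining recursion, peeling off the constant term of the right factor.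
  -- Commutativity follows by matching the two.
  ⊛-unfoldʳ : ∀ f g n → (f ⊛ g) (suc n) ≡ f (suc n) ℤ.* g 0 ℤ.+ (f ⊛ g ∘ suc) n
  ⊛-unfoldʳ f g zero = ℤ.+-comm (f 0 ℤ.* g 1) _
  ⊛-unfoldʳ f g (suc n) rewrite ⊛-unfoldʳ (f ∘ suc) g n =
    ℤ-solve 3 (λ a b c → a ⟨+⟩ (b ⟨+⟩ c) :≡ b ⟨+⟩ (a ⟨+⟩ c)) refl (f 0 ℤ.* g (suc (suc n)))
      (f (suc (suc n)) ℤ.* g 0) _

  ⊛-comm : ∀ f g n → (f ⊛ g) n ≡ (g ⊛ f) n
  ⊛-comm f g zero = ℤ.*-comm (f 0) (g 0)
  ⊛-comm f g (suc n) = trans (cong₂ ℤ._+_ (ℤ.*-comm (f 0) (g (suc n))) (⊛-comm (f ∘ suc) g n)) (sym (⊛-unfoldʳ g f n))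

  ≈-setoid : Setoid 0ℓ 0ℓ
  ≈-setoid = record { Carrier = Series ; _≈_ = _≈_ ;
    isEquivalence = record { refl = ≈-refl ; sym = ≈-sym ; trans = ≈-trans } }

  open import Algebra.Consequences.Setoid ≈-setoid using (comm∧idˡ⇒id; comm∧invˡ⇒inv; comm∧distrʳ⇒distr)

  seriesRing : CommutativeRing 0ℓ 0ℓ
  seriesRing = record
    { Carrier = Series ; _≈_ = _≈_ ; _+_ = _⊕_ ; _*_ = _⊛_ ; -_ = ⊖_ ; 0# = const (+ 0) ; 1# = const (+ 1)
    ; isCommutativeRing = record
      { isRing = record
        { +-isAbelianGroup = record
          { isGroup = record
            { isMonoid = record
              { isSemigroup = record
                { isMagma = record
                  { isEquivalence = Setoid.isEquivalence ≈-setoid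
                  ; ∙-cong = ⊕-cong }
                ; assoc = ⊕-assoc }
              ; identity = comm∧idˡ⇒id ⊕-comm ⊕-identityˡ }
            ; inverse = comm∧invˡ⇒inv ⊕-comm ⊕-inverseˡ
            ; ⁻¹-cong = ⊖-cong }
          ; comm = ⊕-comm }
        ; *-cong = ⊛-cong
        ; *-assoc = λ f g h → pointwise (⊛-assoc f g h)
        ; *-identity = comm∧idˡ⇒id (λ f g → pointwise (⊛-comm f g)) identityˡ
        ; distrib = comm∧distrʳ⇒distr ⊕-cong (λ f g → pointwise (⊛-comm f g)) λ f g h → pointwise (⊛-distribʳ f g h) }
      ; *-comm = λ f g → pointwise (⊛-comm f g) } }
    where
    identityˡ : ∀ f → const (+ 1) ⊛ f ≈ f
    identityˡ f = pointwise λ n → trans (const-⊛ (+ 1) f n) (ℤ.*-identityˡ (f n))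

  const-morphism : CommutativeRing.rawRing ℤ.+-*-commutativeRing -Raw-AlmostCommutative⟶ fromCommutativeRing seriesRing
  const-morphism = record
    { ⟦_⟧ = const
    ; +-homo = const-⊕
    ; *-homo = λ a b → pointwise λ { zero → refl ; (suc n) → sym (trans (const-⊛ a (const b) (suc n)) (ℤ.*-zeroʳ a)) }
    ; -‿homo = const-⊖
    ; 0-homo = ≈-refl
    ; 1-homo = ≈-refl }

  const-≟ : WeaklyDecidable λ a b → const a ≈ const b
  const-≟ a b = Maybe.map (≡⇒≈ ∘ cong const) (dec⇒weaklyDec ℤ._≟_ a b)

  module Solver = Algebra.Solver.Ring
    (CommutativeRing.rawRing ℤ.+-*-commutativeRing) (fromCommutativeRing seriesRing) const-morphism const-≟

  X^-+ : ∀ a b → X^ (a ℕ.+ b) ≈ X^ a ⊛ X^ b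
  X^-+ zero b = ≈-sym (CommutativeRing.*-identityˡ seriesRing (X^ b))
  X^-+ (suc a) b = ≈-sym (≈-trans (X·-⊛ (X^ a) (X^ b))
    (pointwise λ { zero → refl ; (suc n) → sym (at (X^-+ a b) n) }))

  X^-⊛-low : ∀ k f n → n < k → (X^ k ⊛ f) n ≡ + 0
  X^-⊛-low (suc k) f zero n<k = at (X·-⊛ (X^ k) f) 0
  X^-⊛-low (suc k) f (suc n) (s≤s n<k) = trans (at (X·-⊛ (X^ k) f) (suc n)) (X^-⊛-low k f n n<k)

  X^-⊛-high : ∀ k f n → (X^ k ⊛ f) (k ℕ.+ n) ≡ f n
  X^-⊛-high zero f n = at (CommutativeRing.*-identityˡ seriesRing f) n
  X^-⊛-high (suc k) f n = trans (at (X·-⊛ (X^ k) f) (suc k ℕ.+ n)) (X^-⊛-high k f n)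

-- Gauss' identity: the overpartition series is inverse to the alternating theta series

module GaussTheta where

  open PowerSeries
  open Solver using (solve; _:=_; _:+_; _:*_; :-_; con)
  open CommutativeRing seriesRing using (setoid; +-identityʳ; *-assoc; distribʳ; zeroʳ) renaming
    (*-identityˡ to ⊛-identityˡ)
  open import Relation.Binary.Reasoning.Setoid setoid

  sumMult-zero : ∀ j f n m → n < suc j → sumMult (suc j) f n m ≡ 0
  sumMult-zero j f n zero n<j = refl
  sumMult-zero j f n (suc m) n<j with suc m ℕ.* suc j ≤ᵇ n in eq
  ... | false = trans (ℕ.+-identityʳ _) (sumMult-zero j f n m n<j)
  ... | true = contradiction (ℕ.≤-trans (ℕ.m≤m+n (suc j) (m ℕ.* suc j)) (ℕ.≤ᵇ⇒≤ _ n (subst T (sym eq) _))) (ℕ.<⇒≱ n<j)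

  ≤ᵇ-+ : ∀ j a b → (j ℕ.+ a ≤ᵇ j ℕ.+ b) ≡ (a ≤ᵇ b)
  ≤ᵇ-+ zero a b = refl
  ≤ᵇ-+ (suc zero) zero b = refl
  ≤ᵇ-+ (suc zero) (suc a) b = refl
  ≤ᵇ-+ (suc (suc j)) a b = ≤ᵇ-+ (suc j) a b

  sumMult-shift : ∀ j f n m → sumMult j f (j ℕ.+ n) (suc m) ≡ f n ℕ.+ sumMult j f n m
  sumMult-shift j f n zero
    rewrite ℕ.*-identityˡ j | trans (cong (_≤ᵇ j ℕ.+ n) (sym (ℕ.+-identityʳ j))) (≤ᵇ-+ j 0 n) | ℕ.m+n∸m≡n j n =
      sym (ℕ.+-identityʳ (f n))
  sumMult-shift j f n (suc m)
    rewrite sumMult-shift j f n m | ≤ᵇ-+ j (suc m ℕ.* j) n | ℕ.[m+n]∸[m+o]≡n∸o j n (suc m ℕ.* j) = ℕ.+-assoc (f n) _ _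

  -- A positive part occurs at most `n` times in a partition of `n`, so further fuel adds only
  -- zeros. Such surplus fuel appears after `sumMult-shift`, which lowers the argument by the part
  -- but the fuel by one.
  sumMult-fuel : ∀ j f n d → sumMult (suc j) f n (d ℕ.+ n) ≡ sumMult (suc j) f n n
  sumMult-fuel j f n zero = refl
  sumMult-fuel j f n (suc d) with suc (d ℕ.+ n) ℕ.* suc j ≤ᵇ n in eq
  ... | false = trans (ℕ.+-identityʳ _) (sumMult-fuel j f n d)
  ... | true = contradiction (ℕ.≤ᵇ⇒≤ _ n (subst T (sym eq) _))
    (ℕ.<⇒≱ (ℕ.≤-trans (s≤s (ℕ.m≤n+m n d)) (ℕ.m≤m*n (suc (d ℕ.+ n)) (suc j))))

  cast : (ℕ → ℕ) → Series
  cast f n = + f n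

  multiples : ℕ → (ℕ → ℕ) → ℕ → ℕ
  multiples j f n = sumMult j f n n

  -- Removing one copy of the part leaves either no copy or at least one. This is the geometric
  -- series x + x² + ... times `f`, characterised by its fixed-point equation instead of a quotient.
  multiples-rec : ∀ j f → cast (multiples (suc j) f) ≈ X^ (suc j) ⊛ (cast f ⊕ cast (multiples (suc j) f))
  multiples-rec j f = pointwise coefficient
    where
    coefficient : ∀ n → + multiples (suc j) f n ≡ (X^ (suc j) ⊛ (cast f ⊕ cast (multiples (suc j) f))) n
    coefficient n with ℕ.<-≤-connex n (suc j)
    ... | inj₁ n<j = trans (cong +_ (sumMult-zero j f n n n<j)) (sym (X^-⊛-low (suc j) _ n n<j))
    ... | inj₂ j≤n with ℕ.m≤n⇒∃[o]m+o≡n j≤n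
    ... | m , refl = trans
      (cong +_ (trans (sumMult-shift (suc j) f m (j ℕ.+ m)) (cong (f m ℕ.+_) (sumMult-fuel j f m j))))
      (sym (trans (X^-⊛-high (suc j) _ m) (⊕-at (cast f) (cast (multiples (suc j) f)) m)))

  1S 2S : Series
  1S = const (+ 1)
  2S = const (+ 2)

  -- Ordinary partitions with parts at most `k`: the recursion of `opBounded` without the factor 2
  -- for overlining. They supply 1 / (X)_k.
  boundedParts : ℕ → ℕ → ℕ
  boundedParts zero = opBounded zero
  boundedParts (suc k) n = boundedParts k n ℕ.+ multiples (suc k) (boundedParts k) n

  -- p k = ∏ 1 / (1 - Xⁱ) and P k = ∏ (1 + Xⁱ) / (1 - Xⁱ), over 1 ≤ i ≤ k
  p P : ℕ → Series
  p k = cast (boundedParts k)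
  P k = cast (opBounded k)

  p₀ : p 0 ≈ 1S
  p₀ = pointwise λ { zero → refl ; (suc n) → refl }

  -- The factor for one part size is 1 + 2x / (1 - x) = (1 + x) / (1 - x), here with the denominator
  -- cleared.
  P-suc : ∀ k → (1S ⊕ ⊖ X^ (suc k)) ⊛ P (suc k) ≈ (1S ⊕ X^ (suc k)) ⊛ P k
  P-suc k = begin
    (1S ⊕ ⊖ x) ⊛ P (suc k)                       ≈⟨ ⊛-cong ≈-refl cast-P ⟩
    (1S ⊕ ⊖ x) ⊛ (P k ⊕ 2S ⊛ S)
      ≈⟨ solve 3 (λ x P S → (con (+ 1) :+ :- x) :* (P :+ con (+ 2) :* S)
           := (con (+ 1) :+ :- x) :* P :+ con (+ 2) :* (S :+ :- (x :* S))) ≈-refl x (P k) S ⟩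
    (1S ⊕ ⊖ x) ⊛ P k ⊕ 2S ⊛ (S ⊕ ⊖ (x ⊛ S))
      ≈⟨ ⊕-cong ≈-refl (⊛-cong ≈-refl (⊕-cong (multiples-rec k (opBounded k)) ≈-refl)) ⟩
    (1S ⊕ ⊖ x) ⊛ P k ⊕ 2S ⊛ (x ⊛ (P k ⊕ S) ⊕ ⊖ (x ⊛ S))
      ≈⟨ solve 3 (λ x P S → (con (+ 1) :+ :- x) :* P :+ con (+ 2) :* (x :* (P :+ S) :+ :- (x :* S))
           := (con (+ 1) :+ x) :* P) ≈-refl x (P k) S ⟩
    (1S ⊕ x) ⊛ P k                                 ∎
    where
    x S : Series
    x = X^ (suc k)
    S = cast (multiples (suc k) (opBounded k))
    cast-P : P (suc k) ≈ P k ⊕ 2S ⊛ S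
    cast-P = pointwise λ n → trans
      (cong (λ z → P k n ℤ.+ z) (trans (ℤ.pos-* 2 (multiples (suc k) (opBounded k) n)) (sym (const-⊛ (+ 2) S n))))
      (sym (⊕-at (P k) (2S ⊛ S) n))

  p-suc : ∀ k → p k ≈ p (suc k) ⊛ (1S ⊕ ⊖ X^ (suc k))
  p-suc k = ≈-sym (begin
    p (suc k) ⊛ (1S ⊕ ⊖ x)                       ≈⟨ ⊛-cong (pointwise λ n → sym (⊕-at (p k) S n)) ≈-refl ⟩
    (p k ⊕ S) ⊛ (1S ⊕ ⊖ x)
      ≈⟨ solve 3 (λ x p S → (p :+ S) :* (con (+ 1) :+ :- x) := p :+ S :+ :- (x :* (p :+ S))) ≈-refl x (p k) S ⟩
    p k ⊕ S ⊕ ⊖ (x ⊛ (p k ⊕ S))                  ≈⟨ ⊕-cong (⊕-cong ≈-refl (multiples-rec k (boundedParts k))) ≈-refl ⟩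
    p k ⊕ x ⊛ (p k ⊕ S) ⊕ ⊖ (x ⊛ (p k ⊕ S))
      ≈⟨ solve 2 (λ p y → p :+ y :+ :- y := p) ≈-refl (p k) (x ⊛ (p k ⊕ S)) ⟩
    p k ∎)
    where
    x S : Series
    x = X^ (suc k)
    S = cast (multiples (suc k) (boundedParts k))

  sign : ℕ → ℤ
  sign zero = + 1
  sign (suc n) = ℤ.- sign n

  sgn : ℕ → Series
  sgn n = const (sign n)

  sgn-suc : ∀ n → sgn (suc n) ≈ ⊖ sgn n
  sgn-suc n = const-⊖ (sign n)

  term : ℕ → ℕ → Series
  term n j = sgn j ⊛ X^ (j ℕ.* j) ⊛ p (n ∸ j) ⊛ p (n ℕ.+ j)

  sumTerms : ℕ → ℕ → Series
  sumTerms n zero = p n ⊛ p n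
  sumTerms n (suc J) = sumTerms n J ⊕ 2S ⊛ term n (suc J)

  -- D n = ∑ (-1)ʲ X^(j²) / ((X)_{n-j} (X)_{n+j}) over -n ≤ j ≤ n, folded along j ↦ -j
  D : ℕ → Series
  D n = sumTerms n n

  -- The certificate: the j-th term of D (n+1) (1 - X^(2n+2)) - D n is G n j - G n (j-1).
  G : ℕ → ℕ → Series
  G n J = sgn J ⊛ X^ (J ℕ.* J ℕ.+ J ℕ.+ suc n) ⊛ p (n ∸ J) ⊛ p (suc n ℕ.+ J)

  -- With `u` = X^(n-j) and `v` = X^(n+j+2) one has uv = X^(2n+2), and up to the common factor
  -- `s ⊛ w ⊛ pA ⊛ pB` both sides equal 2(u - 1). Writing n as `suc j ℕ.+ r` makes n - j the
  -- successor of `r`, so that the recurrence of `p` applies to it.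
  telescope-step : ∀ j r → let n = suc j ℕ.+ r in
    2S ⊛ term (suc n) (suc j) ⊛ (1S ⊕ ⊖ (X^ (suc n) ⊛ X^ (suc n))) ⊕ 2S ⊛ G n j
      ≈ 2S ⊛ term n (suc j) ⊕ 2S ⊛ G n (suc j)
  telescope-step j r = begin
    2S ⊛ term (suc n) (suc j) ⊛ (1S ⊕ ⊖ (X^ (suc n) ⊛ X^ (suc n))) ⊕ 2S ⊛ G n j
      ≈⟨ ⊕-cong (⊛-cong (⊛-cong ≈-refl (⊛-cong (⊛-cong (⊛-cong (sgn-suc j) ≈-refl) (≡⇒≈ (cong p n∸j))) ≈-refl))
        (⊕-cong ≈-refl (⊖-cong xx)))
                (⊛-cong ≈-refl (⊛-cong (⊛-cong (⊛-cong ≈-refl wu) (≡⇒≈ (cong p n∸j)))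
                  (≡⇒≈ (cong p (sym (ℕ.+-suc n j)))))) ⟩
    2S ⊛ (⊖ s ⊛ w ⊛ pA ⊛ pB) ⊛ (1S ⊕ ⊖ (u ⊛ v)) ⊕ 2S ⊛ (s ⊛ (w ⊛ u) ⊛ pA ⊛ pb)
      ≈⟨ ⊕-cong ≈-refl (⊛-cong ≈-refl (⊛-cong ≈-refl b-rec)) ⟩
    2S ⊛ (⊖ s ⊛ w ⊛ pA ⊛ pB) ⊛ (1S ⊕ ⊖ (u ⊛ v)) ⊕ 2S ⊛ (s ⊛ (w ⊛ u) ⊛ pA ⊛ (pB ⊛ (1S ⊕ ⊖ v)))
      ≈⟨ solve 6 (λ s w u v a b →
           con (+ 2) :* (:- s :* w :* a :* b) :* (con (+ 1) :+ :- (u :* v)) :+ con (+ 2) :*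
             (s :* (w :* u) :* a :* (b :* (con (+ 1) :+ :- v)))
           := con (+ 2) :* (:- s :* w :* (a :* (con (+ 1) :+ :- u)) :* (b :* (con (+ 1) :+ :- v)))
              :+ con (+ 2) :* (:- s :* (w :* v) :* (a :* (con (+ 1) :+ :- u)) :* b)) ≈-refl s w u v pA pB ⟩
    2S ⊛ (⊖ s ⊛ w ⊛ (pA ⊛ (1S ⊕ ⊖ u)) ⊛ (pB ⊛ (1S ⊕ ⊖ v))) ⊕ 2S ⊛ (⊖ s ⊛ (w ⊛ v) ⊛ (pA ⊛ (1S ⊕ ⊖ u)) ⊛ pB)
      ≈⟨ ⊕-cong (⊛-cong ≈-refl (⊛-cong (⊛-cong (⊛-cong (≈-sym (sgn-suc j)) ≈-refl) a-rec) (≈-sym b-rec)))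
                (⊛-cong ≈-refl (⊛-cong (⊛-cong (⊛-cong (≈-sym (sgn-suc j)) wv) a-rec) ≈-refl)) ⟩
    2S ⊛ term n (suc j) ⊕ 2S ⊛ G n (suc j) ∎
    where
    n = suc j ℕ.+ r
    s = sgn j
    w = X^ (suc j ℕ.* suc j)
    u = X^ (suc r)
    v = X^ (suc (n ℕ.+ suc j))
    pA = p (suc r)
    pB = p (suc n ℕ.+ suc j)
    pb = p (n ℕ.+ suc j)
    n∸j : n ∸ j ≡ suc r
    n∸j = trans (cong (_∸ j) (sym (ℕ.+-suc j r))) (ℕ.m+n∸m≡n j (suc r))
    a-rec : pA ⊛ (1S ⊕ ⊖ u) ≈ p (n ∸ suc j)
    a-rec = ≈-trans (≈-sym (p-suc r)) (≡⇒≈ (cong p (sym (ℕ.m+n∸m≡n (suc j) r))))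
    b-rec : pb ≈ pB ⊛ (1S ⊕ ⊖ v)
    b-rec = p-suc (n ℕ.+ suc j)
    X^-≡ : ∀ {a b c} → a ≡ b ℕ.+ c → X^ a ≈ X^ b ⊛ X^ c
    X^-≡ {b = b} {c} refl = X^-+ b c
    xx : X^ (suc n) ⊛ X^ (suc n) ≈ u ⊛ v
    xx = ≈-trans (≈-sym (X^-+ (suc n) (suc n))) (X^-≡ {suc n ℕ.+ suc n} {suc r} (ℕS.solve 2 (λ j r →
      let n = ℕS.con 1 ℕS.:+ j ℕS.:+ r in
      (ℕS.con 1 ℕS.:+ n) ℕS.:+ (ℕS.con 1 ℕS.:+ n) ℕS.:= (ℕS.con 1 ℕS.:+ r) ℕS.:+
        (ℕS.con 1 ℕS.:+ (n ℕS.:+ (ℕS.con 1 ℕS.:+ j)))) refl j r))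
    wu : X^ (j ℕ.* j ℕ.+ j ℕ.+ suc n) ≈ w ⊛ u
    wu = X^-≡ {b = suc j ℕ.* suc j} (ℕS.solve 2 (λ j r →
      j ℕS.:* j ℕS.:+ j ℕS.:+ (ℕS.con 2 ℕS.:+ j ℕS.:+ r) ℕS.:= (ℕS.con 1 ℕS.:+ j) ℕS.:* (ℕS.con 1 ℕS.:+ j) ℕS.:+
        (ℕS.con 1 ℕS.:+ r)) refl j r)
    wv : w ⊛ v ≈ X^ (suc j ℕ.* suc j ℕ.+ suc j ℕ.+ suc n)
    wv = ≈-sym (X^-≡ {b = suc j ℕ.* suc j} (ℕS.solve 2 (λ q n →
      q ℕS.:* q ℕS.:+ q ℕS.:+ (ℕS.con 1 ℕS.:+ n) ℕS.:= q ℕS.:* q ℕS.:+ (ℕS.con 1 ℕS.:+ (n ℕS.:+ q))) refl (suc j) n))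

  telescope : ∀ n J → J ≤ n → sumTerms (suc n) J ⊛ (1S ⊕ ⊖ (X^ (suc n) ⊛ X^ (suc n))) ≈ sumTerms n J ⊕ 2S ⊛ G n J
  telescope n zero _ = begin
    p (suc n) ⊛ p (suc n) ⊛ (1S ⊕ ⊖ (x ⊛ x))
      -- The central term j = 0 is not doubled; for it the certificate amounts to 1 - x² = (1 - x)²
      -- + 2x(1 - x).
      ≈⟨ solve 2 (λ x a → a :* a :* (con (+ 1) :+ :- (x :* x))
        := a :* (con (+ 1) :+ :- x) :* (a :* (con (+ 1) :+ :- x)) :+ con (+ 2) :*
        (con (+ 1) :* x :* (a :* (con (+ 1) :+ :- x)) :* a)) ≈-refl x (p (suc n)) ⟩
    y ⊛ y ⊕ 2S ⊛ (1S ⊛ x ⊛ y ⊛ p (suc n))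
      ≈⟨ ⊕-cong (⊛-cong (≈-sym (p-suc n)) (≈-sym (p-suc n)))
        (⊛-cong ≈-refl (⊛-cong (⊛-cong ≈-refl (≈-sym (p-suc n))) (≡⇒≈ (cong p (sym (ℕ.+-identityʳ (suc n))))))) ⟩
    p n ⊛ p n ⊕ 2S ⊛ G n 0 ∎
    where
    x = X^ (suc n)
    y = p (suc n) ⊛ (1S ⊕ ⊖ x)
  telescope n (suc J) J<n with ℕ.m≤n⇒∃[o]m+o≡n J<n
  ... | r , refl = begin
    (sumTerms (suc n) J ⊕ 2S ⊛ term (suc n) (suc J)) ⊛ (1S ⊕ ⊖ (x ⊛ x))
      ≈⟨ distribʳ (1S ⊕ ⊖ (x ⊛ x)) (sumTerms (suc n) J) (2S ⊛ term (suc n) (suc J)) ⟩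
    sumTerms (suc n) J ⊛ (1S ⊕ ⊖ (x ⊛ x)) ⊕ 2S ⊛ term (suc n) (suc J) ⊛ (1S ⊕ ⊖ (x ⊛ x))
      ≈⟨ ⊕-cong (telescope n J (ℕ.<⇒≤ J<n)) ≈-refl ⟩
    sumTerms n J ⊕ 2S ⊛ G n J ⊕ 2S ⊛ term (suc n) (suc J) ⊛ (1S ⊕ ⊖ (x ⊛ x))
      ≈⟨ solve 3 (λ a b c → a :+ b :+ c := a :+ (c :+ b)) ≈-refl (sumTerms n J) (2S ⊛ G n J)
        (2S ⊛ term (suc n) (suc J) ⊛ (1S ⊕ ⊖ (x ⊛ x))) ⟩
    sumTerms n J ⊕ (2S ⊛ term (suc n) (suc J) ⊛ (1S ⊕ ⊖ (x ⊛ x)) ⊕ 2S ⊛ G n J)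
      ≈⟨ ⊕-cong ≈-refl (telescope-step J r) ⟩
    sumTerms n J ⊕ (2S ⊛ term n (suc J) ⊕ 2S ⊛ G n (suc J))
      ≈⟨ ⊕-assoc (sumTerms n J) _ _ ⟨
    sumTerms n (suc J) ⊕ 2S ⊛ G n (suc J) ∎
    where
    x = X^ (suc n)

  -- The outermost term j = n + 1 of `D (suc n)` has no partner in `D n`; it cancels the boundary
  -- term `G n n` left by the telescope.
  D-suc : ∀ n → D (suc n) ⊛ (1S ⊕ ⊖ (X^ (suc n) ⊛ X^ (suc n))) ≈ D n
  D-suc n = begin
    (sumTerms (suc n) n ⊕ 2S ⊛ term (suc n) (suc n)) ⊛ (1S ⊕ ⊖ (x ⊛ x))
      ≈⟨ distribʳ (1S ⊕ ⊖ (x ⊛ x)) (sumTerms (suc n) n) (2S ⊛ term (suc n) (suc n)) ⟩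
    sumTerms (suc n) n ⊛ (1S ⊕ ⊖ (x ⊛ x)) ⊕ 2S ⊛ term (suc n) (suc n) ⊛ (1S ⊕ ⊖ (x ⊛ x))
      ≈⟨ ⊕-cong (telescope n n ℕ.≤-refl)
        (⊛-cong (⊛-cong ≈-refl (⊛-cong (⊛-cong (⊛-cong (sgn-suc n) ≈-refl) (≡⇒≈ (cong p (ℕ.n∸n≡0 n)))) ≈-refl))
        ≈-refl) ⟩
    D n ⊕ 2S ⊛ G n n ⊕ 2S ⊛ (⊖ s ⊛ w ⊛ p 0 ⊛ pB) ⊛ (1S ⊕ ⊖ (x ⊛ x))
      ≈⟨ ⊕-cong (⊕-cong ≈-refl (⊛-cong ≈-refl
        (⊛-cong (⊛-cong (⊛-cong ≈-refl (≡⇒≈ (cong X^ exponent))) (≡⇒≈ (cong p (ℕ.n∸n≡0 n)))) b-rec))) ≈-refl ⟩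
    D n ⊕ 2S ⊛ (s ⊛ w ⊛ p 0 ⊛ (pB ⊛ (1S ⊕ ⊖ (x ⊛ x)))) ⊕ 2S ⊛ (⊖ s ⊛ w ⊛ p 0 ⊛ pB) ⊛ (1S ⊕ ⊖ (x ⊛ x))
      ≈⟨ solve 6 (λ d s w z b x → d :+ con (+ 2) :* (s :* w :* z :* (b :* (con (+ 1) :+ :- (x :* x)))) :+ con (+ 2) :*
        (:- s :* w :* z :* b) :* (con (+ 1) :+ :- (x :* x)) := d) ≈-refl (D n) s w (p 0) pB x ⟩
    D n ∎
    where
    x = X^ (suc n)
    s = sgn n
    w = X^ (suc n ℕ.* suc n)
    pB = p (suc n ℕ.+ suc n)
    exponent : n ℕ.* n ℕ.+ n ℕ.+ suc n ≡ suc n ℕ.* suc n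
    exponent = ℕS.solve 1 (λ n → n ℕS.:* n ℕS.:+ n ℕS.:+ (ℕS.con 1 ℕS.:+ n) ℕS.:= (ℕS.con 1 ℕS.:+ n) ℕS.:*
      (ℕS.con 1 ℕS.:+ n)) refl n
    b-rec : p (suc n ℕ.+ n) ≈ pB ⊛ (1S ⊕ ⊖ (x ⊛ x))
    b-rec = ≈-trans (≡⇒≈ (cong p (sym (ℕ.+-suc n n)))) (≈-trans (p-suc (n ℕ.+ suc n))
      (⊛-cong ≈-refl (⊕-cong ≈-refl (⊖-cong (X^-+ (suc n) (suc n))))))

  infix 4 _≈[_]_
  -- Congruence modulo Xⁿ, the finite stand-in for convergence.
  record _≈[_]_ (f : Series) (n : ℕ) (g : Series) : Set where
    constructor below
    field at< : ∀ m → m < n → f m ≡ g m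
  open _≈[_]_ public

  ≈⇒≈[] : ∀ {f g n} → f ≈ g → f ≈[ n ] g
  ≈⇒≈[] p = below λ m _ → at p m

  ≈[]-sym : ∀ {f g n} → f ≈[ n ] g → g ≈[ n ] f
  ≈[]-sym p = below λ m m<n → sym (at< p m m<n)

  ≈[]-trans : ∀ {f g h n} → f ≈[ n ] g → g ≈[ n ] h → f ≈[ n ] h
  ≈[]-trans p q = below λ m m<n → trans (at< p m m<n) (at< q m m<n)

  ≈[]-weaken : ∀ {f g m n} → m ≤ n → f ≈[ n ] g → f ≈[ m ] g
  ≈[]-weaken m≤n p = below λ i i<m → at< p i (ℕ.<-≤-trans i<m m≤n)

  ⊕-cong[] : ∀ {f f′ g g′ n} → f ≈[ n ] f′ → g ≈[ n ] g′ → f ⊕ g ≈[ n ] f′ ⊕ g′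
  ⊕-cong[] {f} {f′} {g} {g′} p q = below λ m m<n →
    trans (⊕-at f g m) (trans (cong₂ ℤ._+_ (at< p m m<n) (at< q m m<n)) (sym (⊕-at f′ g′ m)))

  ⊛-cong[] : ∀ {f f′ g g′ n} → f ≈[ n ] f′ → g ≈[ n ] g′ → f ⊛ g ≈[ n ] f′ ⊛ g′
  ⊛-cong[] p q = below λ m m<n →
    ⊛-local m (λ i i≤m → at< p i (ℕ.≤-<-trans i≤m m<n)) (λ i i≤m → at< q i (ℕ.≤-<-trans i≤m m<n))

  X^-⊛-cong[] : ∀ k {f g n} → f ≈[ n ] g → X^ k ⊛ f ≈[ k ℕ.+ n ] X^ k ⊛ g
  X^-⊛-cong[] zero {f} {g} p = ≈[]-trans (≈⇒≈[] (⊛-identityˡ f)) (≈[]-trans p (≈⇒≈[] (≈-sym (⊛-identityˡ g))))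
  X^-⊛-cong[] (suc k) {f} {g} p = ≈[]-trans (≈⇒≈[] (X·-⊛ (X^ k) f)) (≈[]-trans
    (below λ { zero _ → refl ; (suc m) (s≤s m<n) → at< (X^-⊛-cong[] k p) m m<n })
    (≈⇒≈[] (≈-sym (X·-⊛ (X^ k) g))))

  -- A part larger than `k` cannot occur in a partition of a number that is at most `k`.
  p-stable : ∀ d k → p (d ℕ.+ k) ≈[ suc k ] p k
  p-stable zero k = ≈⇒≈[] ≈-refl
  p-stable (suc d) k = ≈[]-trans
    (below λ m m<k → cong +_ (trans
      (cong (boundedParts (d ℕ.+ k) m ℕ.+_) (sumMult-zero (d ℕ.+ k) _ m m (ℕ.≤-trans m<k (s≤s (ℕ.m≤n+m k d)))))
      (ℕ.+-identityʳ _)))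
    (p-stable d k)

  P-stable : ∀ d k → P (d ℕ.+ k) ≈[ suc k ] P k
  P-stable zero k = ≈⇒≈[] ≈-refl
  P-stable (suc d) k = ≈[]-trans
    (below λ m m<k → cong +_ (trans
      (cong (λ z → opBounded (d ℕ.+ k) m ℕ.+ 2 ℕ.* z)
      (sumMult-zero (d ℕ.+ k) _ m m (ℕ.≤-trans m<k (s≤s (ℕ.m≤n+m k d))))) (ℕ.+-identityʳ _)))
    (P-stable d k)

  p-stable-≤ : ∀ {k l} → k ≤ l → p k ≈[ suc k ] p l
  p-stable-≤ {k} k≤l with ℕ.m≤n⇒∃[o]m+o≡n k≤l
  ... | d , refl = ≈[]-sym (subst (λ l → p l ≈[ suc k ] p k) (ℕ.+-comm d k) (p-stable d k))

  P-stable-≤ : ∀ {k l} → k ≤ l → P k ≈[ suc k ] P l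
  P-stable-≤ {k} k≤l with ℕ.m≤n⇒∃[o]m+o≡n k≤l
  ... | d , refl = ≈[]-sym (subst (λ l → P l ≈[ suc k ] P k) (ℕ.+-comm d k) (P-stable d k))

  -- φ n is ∑ (-1)ʲ X^(j²) over -n ≤ j ≤ n.
  φ : ℕ → Series
  φ zero = 1S
  φ (suc n) = φ n ⊕ 2S ⊛ (sgn (suc n) ⊛ X^ (suc n ℕ.* suc n))

  -- For index i = j + 1, `p (n ∸ i)` agrees with `p n` only modulo X^(n-i+1). The factor X^(i²)
  -- restores the missing precision, since i² ≥ i.
  term-φ : ∀ n j → suc j ≤ n → term n (suc j) ≈[ suc n ] sgn (suc j) ⊛ X^ (suc j ℕ.* suc j) ⊛ (p n ⊛ p n)
  term-φ n j j<n = ≈[]-trans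
    (≈⇒≈[] (solve 4 (λ s x a b → s :* x :* a :* b := s :* (x :* (a :* b))) ≈-refl s x (p (n ∸ suc j))
      (p (n ℕ.+ suc j))))
    (≈[]-trans
      (⊛-cong[] (≈⇒≈[] (≈-refl {s})) (≈[]-weaken enough
        (X^-⊛-cong[] (suc j ℕ.* suc j) (⊛-cong[] (p-stable-≤ (ℕ.m∸n≤m n (suc j)))
          (≈[]-sym (≈[]-weaken (s≤s (ℕ.m∸n≤m n (suc j))) (p-stable-≤ (ℕ.m≤m+n n (suc j)))))))))
      (≈⇒≈[] (solve 3 (λ s x a → s :* (x :* (a :* a)) := s :* x :* (a :* a)) ≈-refl s x (p n))))
    where
    s = sgn (suc j)
    x = X^ (suc j ℕ.* suc j)
    enough : suc n ≤ suc j ℕ.* suc j ℕ.+ suc (n ∸ suc j)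
    enough = subst₂ _≤_ (trans (ℕ.+-suc (suc j) (n ∸ suc j)) (cong suc (ℕ.m+[n∸m]≡n j<n))) refl
      (ℕ.+-monoˡ-≤ (suc (n ∸ suc j)) (ℕ.m≤m*n (suc j) (suc j)))

  sumTerms-φ : ∀ n J → J ≤ n → sumTerms n J ≈[ suc n ] φ J ⊛ (p n ⊛ p n)
  sumTerms-φ n zero _ = ≈⇒≈[] (≈-sym (⊛-identityˡ (p n ⊛ p n)))
  sumTerms-φ n (suc J) J<n = ≈[]-trans
    (⊕-cong[] (sumTerms-φ n J (ℕ.<⇒≤ J<n)) (⊛-cong[] (≈⇒≈[] (≈-refl {2S})) (term-φ n J J<n)))
    (≈⇒≈[] (solve 4 (λ f t s a → f :* a :+ t :* (s :* a) := (f :+ t :* s) :* a) ≈-refl (φ J) 2S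
      (sgn (suc J) ⊛ X^ (suc J ℕ.* suc J)) (p n ⊛ p n)))

  -- Q k = ∏ (1 - Xⁱ) and E k = ∏ (1 + Xⁱ)
  Q E : ℕ → Series
  Q zero = 1S
  Q (suc k) = Q k ⊛ (1S ⊕ ⊖ X^ (suc k))
  E zero = 1S
  E (suc k) = E k ⊛ (1S ⊕ X^ (suc k))

  Q-p : ∀ k → Q k ⊛ p k ≈ 1S
  Q-p zero = ≈-trans (⊛-identityˡ (p 0)) p₀
  Q-p (suc k) = begin
    Q k ⊛ y ⊛ p (suc k)    ≈⟨ solve 3 (λ q y p → q :* y :* p := q :* (p :* y)) ≈-refl (Q k) y (p (suc k)) ⟩
    Q k ⊛ (p (suc k) ⊛ y)  ≈⟨ ⊛-cong ≈-refl (p-suc k) ⟨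
    Q k ⊛ p k              ≈⟨ Q-p k ⟩
    1S                     ∎
    where y = 1S ⊕ ⊖ X^ (suc k)

  Q-P : ∀ k → Q k ⊛ P k ≈ E k
  Q-P zero = ≈-trans (⊛-identityˡ (P 0)) p₀
  Q-P (suc k) = begin
    Q k ⊛ y ⊛ P (suc k)             ≈⟨ *-assoc (Q k) y (P (suc k)) ⟩
    Q k ⊛ (y ⊛ P (suc k))           ≈⟨ ⊛-cong ≈-refl (P-suc k) ⟩
    Q k ⊛ ((1S ⊕ X^ (suc k)) ⊛ P k)
      ≈⟨ solve 3 (λ q y p → q :* (y :* p) := q :* p :* y) ≈-refl (Q k) (1S ⊕ X^ (suc k)) (P k) ⟩
    Q k ⊛ P k ⊛ (1S ⊕ X^ (suc k))   ≈⟨ ⊛-cong (Q-P k) ≈-refl ⟩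
    E k ⊛ (1S ⊕ X^ (suc k))         ∎
    where y = 1S ⊕ ⊖ X^ (suc k)

  -- From one `k` to the next, `Q ⊛ E` gains (1 - x)(1 + x) = 1 - x², the very factor that `D-suc`
  -- absorbs. This is the finite form of Gauss' identity.
  Q-E-D : ∀ k → Q k ⊛ E k ⊛ D k ≈ 1S
  Q-E-D zero = ≈-trans (⊛-cong (⊛-identityˡ 1S) (⊛-cong p₀ p₀))
    (solve 0 (con (+ 1) :* (con (+ 1) :* con (+ 1)) := con (+ 1)) ≈-refl)
  Q-E-D (suc k) = begin
    Q k ⊛ (1S ⊕ ⊖ x) ⊛ (E k ⊛ (1S ⊕ x)) ⊛ D (suc k)
      ≈⟨ solve 4 (λ q e x d → q :* (con (+ 1) :+ :- x) :* (e :* (con (+ 1) :+ x)) :* d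
        := q :* e :* (d :* (con (+ 1) :+ :- (x :* x)))) ≈-refl (Q k) (E k) x (D (suc k)) ⟩
    Q k ⊛ E k ⊛ (D (suc k) ⊛ (1S ⊕ ⊖ (x ⊛ x)))
      ≈⟨ ⊛-cong ≈-refl (D-suc k) ⟩
    Q k ⊛ E k ⊛ D k
      ≈⟨ Q-E-D k ⟩
    1S ∎
    where x = X^ (suc k)

  -- Inserting (Q p)² = 1 replaces φ by φp², which is `D n` modulo X^(n+1). The remaining PQ² is QE,
  -- and `D n` is its inverse.
  P-φ : ∀ n → P n ⊛ φ n ≈[ suc n ] 1S
  P-φ n = ≈[]-trans (≈⇒≈[] intro)
    (≈[]-trans (⊛-cong[] (≈⇒≈[] (≈-refl {P n ⊛ Q n ⊛ Q n})) (≈[]-sym (sumTerms-φ n n ℕ.≤-refl))) (≈⇒≈[] elim))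
    where
    intro : P n ⊛ φ n ≈ P n ⊛ Q n ⊛ Q n ⊛ (φ n ⊛ (p n ⊛ p n))
    intro = begin
      P n ⊛ φ n
        ≈⟨ solve 2 (λ P f → P :* f := P :* f :* (con (+ 1) :* con (+ 1))) ≈-refl (P n) (φ n) ⟩
      P n ⊛ φ n ⊛ (1S ⊛ 1S)                        ≈⟨ ⊛-cong ≈-refl (⊛-cong (Q-p n) (Q-p n)) ⟨
      P n ⊛ φ n ⊛ (Q n ⊛ p n ⊛ (Q n ⊛ p n))
        ≈⟨ solve 4 (λ P f q p → P :* f :* (q :* p :* (q :* p)) := P :* q :* q :* (f :* (p :* p))) ≈-refl
             (P n) (φ n) (Q n) (p n) ⟩
      P n ⊛ Q n ⊛ Q n ⊛ (φ n ⊛ (p n ⊛ p n))        ∎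
    elim : P n ⊛ Q n ⊛ Q n ⊛ D n ≈ 1S
    elim = begin
      P n ⊛ Q n ⊛ Q n ⊛ D n
        ≈⟨ solve 3 (λ P q d → P :* q :* q :* d := q :* (q :* P) :* d) ≈-refl (P n) (Q n) (D n) ⟩
      Q n ⊛ (Q n ⊛ P n) ⊛ D n    ≈⟨ ⊛-cong (⊛-cong ≈-refl (Q-P n)) ≈-refl ⟩
      Q n ⊛ E n ⊛ D n            ≈⟨ Q-E-D n ⟩
      1S                         ∎

  φ-stable : ∀ d k → φ (d ℕ.+ k) ≈[ suc k ] φ k
  φ-stable zero k = ≈⇒≈[] ≈-refl
  φ-stable (suc d) k = ≈[]-trans (≈[]-trans (⊕-cong[] {n = suc k} (≈⇒≈[] (≈-refl {φ (d ℕ.+ k)})) vanish)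
    (≈⇒≈[] (+-identityʳ (φ (d ℕ.+ k))))) (φ-stable d k)
    where
    N = suc (d ℕ.+ k)
    vanish : 2S ⊛ (sgn N ⊛ X^ (N ℕ.* N)) ≈[ suc k ] const (+ 0)
    vanish = ≈[]-trans (≈⇒≈[] (solve 3 (λ a b c → a :* (b :* c) := c :* (a :* b)) ≈-refl 2S (sgn N) (X^ (N ℕ.* N))))
      (≈[]-trans (≈[]-weaken (ℕ.≤-trans (ℕ.≤-trans (s≤s (ℕ.m≤n+m k d)) (ℕ.m≤m*n N N)) (ℕ.m≤m+n (N ℕ.* N) 0))
        (X^-⊛-cong[] (N ℕ.* N) {g = const (+ 0)} (below λ m ())))
        (≈⇒≈[] (zeroʳ (X^ (N ℕ.* N)))))

  φ-stable-≤ : ∀ {k l} → k ≤ l → φ k ≈[ suc k ] φ l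
  φ-stable-≤ {k} k≤l with ℕ.m≤n⇒∃[o]m+o≡n k≤l
  ... | d , refl = ≈[]-sym (subst (λ l → φ l ≈[ suc k ] φ k) (ℕ.+-comm d k) (φ-stable d k))

  φ∞ : Series
  φ∞ n = φ n n

  -- Both factors are diagonals, of `P` and of `φ`. Coefficient `n` of the product involves only
  -- coefficients up to `n`, where the diagonals agree with `P n` and `φ n`.
  gauss : cast pbar ⊛ φ∞ ≈ 1S
  gauss = pointwise λ n → trans
    (⊛-local n (λ m m≤n → at< (P-stable-≤ m≤n) m ℕ.≤-refl) (λ m m≤n → at< (φ-stable-≤ m≤n) m ℕ.≤-refl))
    (at< (P-φ n) n ℕ.≤-refl)

-- Seventh powers modulo 7 and the extraction of every seventh coefficient

module Frobenius where

  open PowerSeries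
  open Solver using (Polynomial; solve; _:=_; _:+_; _:*_; :-_; con)
  open CommutativeRing seriesRing using (setoid; *-assoc) renaming (*-identityˡ to ⊛-identityˡ)
  open import Relation.Binary.Reasoning.Setoid setoid
  open import Data.Integer.Divisibility.Signed using (_∣_)

  infix 4 _≡₇_
  record _≡₇_ (a b : ℤ) : Set where
    constructor mod₇
    field 7∣- : + 7 ∣ a ℤ.- b
  open _≡₇_ public

  ≡₇-reflexive : ∀ {a b} → a ≡ b → a ≡₇ b
  ≡₇-reflexive {a} refl = mod₇ (divides (+ 0) (ℤ.+-inverseʳ a))

  ≡₇-trans : ∀ {a b c} → a ≡₇ b → b ≡₇ c → a ≡₇ c
  ≡₇-trans {a} {b} {c} (mod₇ p) (mod₇ q) = mod₇ (subst (+ 7 ∣_)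
    (ℤS.solve 3 (λ a b c → (a ℤS.:- b) ℤS.:+ (b ℤS.:- c) ℤS.:= a ℤS.:- c) refl a b c) (∣m∣n⇒∣m+n p q))

  ≡₇-sym : ∀ {a b} → a ≡₇ b → b ≡₇ a
  ≡₇-sym {a} {b} (mod₇ p) = mod₇ (subst (+ 7 ∣_) (ℤS.solve 2 (λ a b → ℤS.:- (a ℤS.:- b) ℤS.:= b ℤS.:- a) refl a b)
    (∣m⇒∣-m p))

  +-cong₇ : ∀ {a a′ b b′} → a ≡₇ a′ → b ≡₇ b′ → a ℤ.+ b ≡₇ a′ ℤ.+ b′
  +-cong₇ {a} {a′} {b} {b′} (mod₇ p) (mod₇ q) = mod₇ (subst (+ 7 ∣_)
    (ℤS.solve 4 (λ a a′ b b′ → (a ℤS.:- a′) ℤS.:+ (b ℤS.:- b′) ℤS.:= (a ℤS.:+ b) ℤS.:- (a′ ℤS.:+ b′)) refl a a′ b b′)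
      (∣m∣n⇒∣m+n p q))

  *-cong₇ : ∀ {a a′ b b′} → a ≡₇ a′ → b ≡₇ b′ → a ℤ.* b ≡₇ a′ ℤ.* b′
  *-cong₇ {a} {a′} {b} {b′} (mod₇ p) (mod₇ q) = mod₇ (subst (+ 7 ∣_)
    (ℤS.solve 4 (λ a a′ b b′ → (a ℤS.:- a′) ℤS.:* b ℤS.:+ a′ ℤS.:* (b ℤS.:- b′) ℤS.:= (a ℤS.:* b) ℤS.:- (a′ ℤS.:* b′))
      refl a a′ b b′)
    (∣m∣n⇒∣m+n (∣m⇒∣m*n b p) (∣n⇒∣m*n a′ q)))

  7*≡₇0 : ∀ a → + 7 ℤ.* a ≡₇ + 0
  7*≡₇0 a = mod₇ (divides a (trans (ℤ.+-identityʳ (+ 7 ℤ.* a)) (ℤ.*-comm (+ 7) a)))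

  ⊛-cong₇ : ∀ {f f′ g g′} → (∀ n → f n ≡₇ f′ n) → (∀ n → g n ≡₇ g′ n) → ∀ n → (f ⊛ g) n ≡₇ (f′ ⊛ g′) n
  ⊛-cong₇ p q zero = *-cong₇ (p 0) (q 0)
  ⊛-cong₇ p q (suc n) = +-cong₇ (*-cong₇ (p 0) (q (suc n))) (⊛-cong₇ (p ∘ suc) q n)

  _⁷ : ℤ → ℤ
  a ⁷ = a ℤ.* a ℤ.* a ℤ.* a ℤ.* a ℤ.* a ℤ.* a

  fermat-ℕ : ∀ n → (+ n) ⁷ ≡₇ + n
  fermat-ℕ zero = ≡₇-reflexive refl
  fermat-ℕ (suc n) = ≡₇-trans (≡₇-reflexive expand) (+-cong₇ {+ 1} (≡₇-reflexive refl)
    (≡₇-trans (+-cong₇ (fermat-ℕ n) (7*≡₇0 _)) (≡₇-reflexive (ℤ.+-identityʳ (+ n)))))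
    where
    -- Cauchy's identity (1 + a)⁷ - 1 - a⁷ = 7a(1 + a)(1 + a + a²)² displays all middle binomial
    -- terms as one multiple of 7.
    expand : (+ 1 ℤ.+ + n) ⁷ ≡ _
    expand = ℤS.solve 1 (λ a → let
        _^7 = λ x → x ℤS.:* x ℤS.:* x ℤS.:* x ℤS.:* x ℤS.:* x ℤS.:* x
        b = ℤS.con (+ 1) ℤS.:+ a ℤS.:+ a ℤS.:* a in
      (ℤS.con (+ 1) ℤS.:+ a) ^7 ℤS.:= ℤS.con (+ 1) ℤS.:+
        (a ^7 ℤS.:+ ℤS.con (+ 7) ℤS.:* (a ℤS.:* (ℤS.con (+ 1) ℤS.:+ a) ℤS.:* (b ℤS.:* b)))) refl (+ n)

  fermat : ∀ a → a ⁷ ≡₇ a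
  fermat (+ n) = fermat-ℕ n
  fermat -[1+ n ] = ≡₇-trans (≡₇-reflexive (ℤS.solve 1 (λ a → let
        _^7 = λ x → x ℤS.:* x ℤS.:* x ℤS.:* x ℤS.:* x ℤS.:* x ℤS.:* x in
      (ℤS.:- a) ^7 ℤS.:= ℤS.con (ℤ.- + 1) ℤS.:* (a ^7)) refl (+ suc n)))
    (≡₇-trans (*-cong₇ {ℤ.- + 1} (≡₇-reflexive refl) (fermat-ℕ (suc n))) (≡₇-reflexive (ℤ.-1*i≡-i (+ suc n))))

  power₇ : Series → Series
  power₇ x = x ⊛ x ⊛ x ⊛ x ⊛ x ⊛ x ⊛ x

  power₇-cong : ∀ {f g} → f ≈ g → power₇ f ≈ power₇ g
  power₇-cong p = ⊛-cong (⊛-cong (⊛-cong (⊛-cong (⊛-cong (⊛-cong p p) p) p) p) p) p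

  power₇-const : ∀ a → power₇ (const a) ≈ const (a ⁷)
  power₇-const a = ≈-sym (h (h (h (h (h (h ≈-refl))))))
    where
    h : ∀ {b f} → const b ≈ f → const (b ℤ.* a) ≈ f ⊛ const a
    h {b} {f} p = ≈-trans (*-homo b a) (⊛-cong p ≈-refl)
      where open _-Raw-AlmostCommutative⟶_ const-morphism

  uncons : ∀ f → f ≈ const (f 0) ⊕ X^ 1 ⊛ (f ∘ suc)
  uncons f = pointwise λ n → trans (coefficient n) (sym (⊕-at (const (f 0)) (X^ 1 ⊛ (f ∘ suc)) n))
    where
    coefficient : ∀ n → f n ≡ const (f 0) n ℤ.+ (X^ 1 ⊛ (f ∘ suc)) n
    coefficient zero = sym (trans (cong (λ z → f 0 ℤ.+ z) (ℤ.*-zeroˡ (f 1))) (ℤ.+-identityʳ (f 0)))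
    coefficient (suc n) = sym (trans (ℤ.+-identityˡ _)
      (trans (at (X·-⊛ (X^ 0) (f ∘ suc)) (suc n)) (at (⊛-identityˡ (f ∘ suc)) n)))

  -- Split `f` into its constant term c and y = X · (`f ∘ suc`). The mixed terms of (c + y)⁷ are
  -- 7cy(c + y)(c² + cy + y²)², the homogeneous form of the identity behind `fermat-ℕ`.
  frobenius-step : ∀ f g → let f′ = f ∘ suc in
    ∃ λ k → power₇ f ⊛ g ≈ const (f 0 ⁷) ⊛ g ⊕ X^ 7 ⊛ (power₇ f′ ⊛ g) ⊕ const (+ 7) ⊛ k
  frobenius-step f g = _ , (begin
    power₇ f ⊛ g                  ≈⟨ ⊛-cong (power₇-cong (uncons f)) ≈-refl ⟩
    power₇ (c ⊕ x ⊛ f′) ⊛ g       ≈⟨ solve 4 (λ c x f g → let y = x :* f in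
        p7 (c :+ y) :* g := p7 c :* g :+ p7 x :* (p7 f :* g) :+ con (+ 7) :*
          (c :* y :* (c :+ y) :* sq (c :* c :+ c :* y :+ y :* y) :* g)) ≈-refl c x f′ g ⟩
    power₇ c ⊛ g ⊕ power₇ x ⊛ (power₇ f′ ⊛ g) ⊕ k
      ≈⟨ ⊕-cong (⊕-cong (⊛-cong (power₇-const (f 0)) ≈-refl) (⊛-cong (x⁷) ≈-refl)) ≈-refl ⟩
    const (f 0 ⁷) ⊛ g ⊕ X^ 7 ⊛ (power₇ f′ ⊛ g) ⊕ k ∎)
    where
    c = const (f 0)
    x = X^ 1
    f′ = f ∘ suc
    y = x ⊛ f′
    k = const (+ 7) ⊛ (c ⊛ y ⊛ (c ⊕ y) ⊛ ((c ⊛ c ⊕ c ⊛ y ⊕ y ⊛ y) ⊛ (c ⊛ c ⊕ c ⊛ y ⊕ y ⊛ y)) ⊛ g)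
    p7 sq : ∀ {n} → Polynomial n → Polynomial n
    p7 x = x :* x :* x :* x :* x :* x :* x
    sq x = x :* x
    x⁷ : power₇ (X^ 1) ≈ X^ 7
    x⁷ = ≈-sym (h {6} (h {5} (h {4} (h {3} (h {2} (h {1} ≈-refl))))))
      where
      h : ∀ {n f} → X^ n ≈ f → X^ (suc n) ≈ f ⊛ X^ 1
      h {n} p = ≈-trans (≡⇒≈ (cong X^ (ℕ.+-comm 1 n))) (≈-trans (X^-+ n 1) (⊛-cong p ≈-refl))

  section : Series → Series
  section f n = f (n ℕ.* 7)

  section-expansion : ∀ {a b F} g h k → a ≡₇ b → F ≈ const a ⊛ g ⊕ X^ 7 ⊛ h ⊕ const (+ 7) ⊛ k →
    ∀ n → F n ≡₇ b ℤ.* g n ℤ.+ (X^ 7 ⊛ h) n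
  section-expansion {a} {b} g h k a≡b expansion n = ≡₇-trans
    (≡₇-reflexive (trans (at expansion n) (trans (⊕-at _ _ n)
      (cong₂ ℤ._+_ (trans (⊕-at (const a ⊛ g) (X^ 7 ⊛ h) n) (cong (ℤ._+ (X^ 7 ⊛ h) n) (const-⊛ a g n)))
        (const-⊛ (+ 7) k n)))))
    (≡₇-trans (+-cong₇ (+-cong₇ (*-cong₇ a≡b (≡₇-reflexive refl)) (≡₇-reflexive refl)) (7*≡₇0 (k n)))
      (≡₇-reflexive (ℤ.+-identityʳ _)))

  X^7-section : ∀ h n → (X^ 7 ⊛ h) (suc n ℕ.* 7) ≡ section h n
  X^7-section h n = X^-⊛-high 7 h (n ℕ.* 7)

  -- This stands in for f(X)⁷ ≡ f(X⁷). By Fermat the expansion of `frobenius-step` begins with `f 0`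
  -- times `g`, and its X⁷ becomes a shift by one in the section, so what remains is the defining
  -- recursion of `f ⊛ section g`.
  section-power₇ : ∀ f g n → section (power₇ f ⊛ g) n ≡₇ (f ⊛ section g) n
  section-power₇ f g zero = let k , expansion = frobenius-step f g ; h = power₇ (f ∘ suc) ⊛ g in
    ≡₇-trans (section-expansion g h k (fermat (f 0)) expansion 0)
      (≡₇-reflexive (trans (cong (λ z → f 0 ℤ.* g 0 ℤ.+ z) (X^-⊛-low 7 h 0 (s≤s z≤n))) (ℤ.+-identityʳ (f 0 ℤ.* g 0))))
  section-power₇ f g (suc n) = let k , expansion = frobenius-step f g ; h = power₇ (f ∘ suc) ⊛ g in
    ≡₇-trans (section-expansion g h k (fermat (f 0)) expansion (suc n ℕ.* 7))
      (+-cong₇ (≡₇-reflexive {f 0 ℤ.* g (suc n ℕ.* 7)} refl)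
        (≡₇-trans (≡₇-reflexive (X^7-section h n)) (section-power₇ (f ∘ suc) g n)))

  -- P³ = P⁷φ⁴, and P⁷ is congruent to a series in X⁷.
  section-cube : ∀ P φ → P ⊛ φ ≈ const (+ 1) → (∀ n → section (φ ⊛ (φ ⊛ (φ ⊛ φ))) n ≡₇ (φ ⊛ (φ ⊛ (φ ⊛ φ))) n) →
    ∀ n → section (P ⊛ (P ⊛ P)) n ≡₇ (φ ⊛ (φ ⊛ φ)) n
  section-cube P φ Pφ≈1 φ⁴ n = ≡₇-trans (≡₇-reflexive (at cube (n ℕ.* 7)))
    (≡₇-trans (section-power₇ P (φ ⊛ (φ ⊛ (φ ⊛ φ))) n)
    (≡₇-trans (⊛-cong₇ (λ m → ≡₇-reflexive {P m} refl) φ⁴ n) (≡₇-reflexive (at cancel n))))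
    where
    y = P ⊛ φ
    1S = const (+ 1)
    cube : P ⊛ (P ⊛ P) ≈ power₇ P ⊛ (φ ⊛ (φ ⊛ (φ ⊛ φ)))
    cube = begin
      P ⊛ (P ⊛ P)
        ≈⟨ solve 1 (λ P → P :* (P :* P)
             := P :* (P :* P) :* (con (+ 1) :* (con (+ 1) :* (con (+ 1) :* con (+ 1))))) ≈-refl P ⟩
      P ⊛ (P ⊛ P) ⊛ (1S ⊛ (1S ⊛ (1S ⊛ 1S)))        ≈⟨ ⊛-cong ≈-refl (⊛-cong Pφ≈1 (⊛-cong Pφ≈1 (⊛-cong Pφ≈1 Pφ≈1))) ⟨
      P ⊛ (P ⊛ P) ⊛ (y ⊛ (y ⊛ (y ⊛ y)))
        ≈⟨ solve 2 (λ P φ → let y = P :* φ in P :* (P :* P) :* (y :* (y :* (y :* y)))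
             := P :* P :* P :* P :* P :* P :* P :* (φ :* (φ :* (φ :* φ)))) ≈-refl P φ ⟩
      power₇ P ⊛ (φ ⊛ (φ ⊛ (φ ⊛ φ))) ∎
    cancel : P ⊛ (φ ⊛ (φ ⊛ (φ ⊛ φ))) ≈ φ ⊛ (φ ⊛ φ)
    cancel = begin
      P ⊛ (φ ⊛ (φ ⊛ (φ ⊛ φ)))     ≈⟨ *-assoc P φ (φ ⊛ (φ ⊛ φ)) ⟨
      P ⊛ φ ⊛ (φ ⊛ (φ ⊛ φ))       ≈⟨ ⊛-cong Pφ≈1 ≈-refl ⟩
      1S ⊛ (φ ⊛ (φ ⊛ φ))          ≈⟨ ⊛-identityˡ (φ ⊛ (φ ⊛ φ)) ⟩
      φ ⊛ (φ ⊛ φ)                 ∎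

-- Powers of the theta series as signed counts of representations by squares

module SumsOfSquares where

  open PowerSeries
  open GaussTheta using (2S; sign; sgn; φ; φ∞)
  open import Data.Integer using (∣_∣)

  private variable A B : Set

  unique-length : {xs ys : List A} → Unique xs → Unique ys → (∀ {x} → x ∈ xs → x ∈ ys) → (∀ {x} → x ∈ ys → x ∈ xs) →
    length xs ≡ length ys
  unique-length u v f g = ↭-length (∼bag⇒↭ (unique∧set⇒bag u v (mk⇔ f g)))

  bijection-length : {xs : List A} {ys : List B} (f : A → B) → (∀ {x y} → f x ≡ f y → x ≡ y) → Unique xs → Unique ys →
    (∀ {x} → x ∈ xs → f x ∈ ys) → (∀ {y} → y ∈ ys → ∃ λ x → x ∈ xs × y ≡ f x) → length xs ≡ length ys
  bijection-length {xs = xs} {ys} f inj u v to from =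
    trans (sym (List.length-map f xs)) (unique-length (Unique.map⁺ inj u) v
    (λ y∈ → let x , x∈ , eq = ∈-map⁻ f y∈ in subst (_∈ ys) (sym eq) (to x∈))
    (λ y∈ → let x , x∈ , eq = from y∈ in subst (_∈ map f xs) (sym eq) (∈-map⁺ f x∈)))

  -- Follows the clauses of `_⊛_` with lists in place of coefficients, which makes `card`
  -- multiplicative.
  conv : (ℕ → List A) → (ℕ → List B) → ℕ → List (A × B)
  conv F G zero = cartesianProduct (F 0) (G 0)
  conv F G (suc n) = cartesianProduct (F 0) (G (suc n)) ++ conv (F ∘ suc) G n

  card : (ℕ → List A) → Series
  card F n = + length (F n)

  length-cartesianProduct : (xs : List A) (ys : List B) → length (cartesianProduct xs ys) ≡ length xs ℕ.* length ys
  length-cartesianProduct [] ys = refl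
  length-cartesianProduct (x ∷ xs) ys =
    trans (List.length-++ (map (x ,_) ys)) (cong₂ ℕ._+_ (List.length-map (x ,_) ys) (length-cartesianProduct xs ys))

  card-conv : (F : ℕ → List A) (G : ℕ → List B) → ∀ n → card (conv F G) n ≡ (card F ⊛ card G) n
  card-conv F G zero = trans (cong +_ (length-cartesianProduct (F 0) (G 0))) (ℤ.pos-* (length (F 0)) (length (G 0)))
  card-conv F G (suc n) = trans (cong +_ (List.length-++ (cartesianProduct (F 0) (G (suc n)))))
    (trans (ℤ.pos-+ (length (cartesianProduct (F 0) (G (suc n)))) _)
    (cong₂ ℤ._+_ (trans (cong +_ (length-cartesianProduct (F 0) (G (suc n))))
      (ℤ.pos-* (length (F 0)) (length (G (suc n))))) (card-conv (F ∘ suc) G n)))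

  ∈-conv⁺ : (F : ℕ → List A) (G : ℕ → List B) → ∀ {a b} i j → a ∈ F i → b ∈ G j → (a , b) ∈ conv F G (i ℕ.+ j)
  ∈-conv⁺ F G zero zero a∈ b∈ = ∈-cartesianProduct⁺ a∈ b∈
  ∈-conv⁺ F G zero (suc j) a∈ b∈ = ∈-++⁺ˡ (∈-cartesianProduct⁺ a∈ b∈)
  ∈-conv⁺ F G (suc i) j a∈ b∈ = ∈-++⁺ʳ _ (∈-conv⁺ (F ∘ suc) G i j a∈ b∈)

  ∈-conv⁻ : (F : ℕ → List A) (G : ℕ → List B) → ∀ {a b} n → (a , b) ∈ conv F G n →
    ∃₂ λ i j → i ℕ.+ j ≡ n × a ∈ F i × b ∈ G j
  ∈-conv⁻ F G zero ab∈ = 0 , 0 , refl , ∈-cartesianProduct⁻ (F 0) (G 0) ab∈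
  ∈-conv⁻ F G (suc n) ab∈ with ∈-++⁻ (cartesianProduct (F 0) (G (suc n))) ab∈
  ... | inj₁ ab∈ = 0 , suc n , refl , ∈-cartesianProduct⁻ (F 0) (G (suc n)) ab∈
  ... | inj₂ ab∈ = let i , j , i+j≡n , a∈ , b∈ = ∈-conv⁻ (F ∘ suc) G n ab∈ in suc i , j , cong suc i+j≡n , a∈ , b∈

  -- A pair could come from two different splittings of `n` only if its first component lay in two
  -- of the lists `F i`.
  unique-conv : (F : ℕ → List A) (G : ℕ → List B) → (∀ n → Unique (F n)) → (∀ n → Unique (G n)) →
    (∀ {a i j} → a ∈ F i → a ∈ F j → i ≡ j) → ∀ n → Unique (conv F G n)
  unique-conv F G u v disjoint zero = Unique.cartesianProduct⁺ (u 0) (v 0)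
  unique-conv F G u v disjoint (suc n) = Unique.++⁺ (Unique.cartesianProduct⁺ (u 0) (v (suc n)))
    (unique-conv (F ∘ suc) G (u ∘ suc) v (λ p q → ℕ.suc-injective (disjoint p q)) n)
    λ { {a , b} (p , q) → let i , _ , _ , a∈ , _ = ∈-conv⁻ (F ∘ suc) G n q in
          contradiction (disjoint (proj₁ (∈-cartesianProduct⁻ (F 0) (G (suc n)) p)) a∈) λ () }

  record Enumerates (F : ℕ → List A) (q : A → ℕ) : Set where
    field
      unique : ∀ n → Unique (F n)
      sound : ∀ {x n} → x ∈ F n → q x ≡ n
      complete : ∀ x → x ∈ F (q x)
  open Enumerates public

  enumerates-conv : {F : ℕ → List A} {G : ℕ → List B} {q : A → ℕ} {r : B → ℕ} →
    Enumerates F q → Enumerates G r → Enumerates (conv F G) λ (a , b) → q a ℕ.+ r b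
  enumerates-conv {F = F} {G} {q} {r} f g = record
    { unique = unique-conv F G (unique f) (unique g) λ a∈ a∈′ → trans (sym (sound f a∈)) (sound f a∈′)
    ; sound = λ {_} {n} ab∈ → let _ , _ , i+j≡n , a∈ , b∈ = ∈-conv⁻ F G n ab∈ in trans
      (cong₂ ℕ._+_ (sound f a∈) (sound g b∈)) i+j≡n
    ; complete = λ (a , b) → ∈-conv⁺ F G (q a) (r b) (complete f a) (complete g b) }

  square : ℤ → ℕ
  square x = ∣ x ∣ ℕ.* ∣ x ∣

  ints : ℕ → List ℤ
  ints zero = + 0 ∷ []
  ints (suc n) = + suc n ∷ -[1+ n ] ∷ ints n

  ∈-ints⁺ : ∀ x n → ∣ x ∣ ≤ n → x ∈ ints n
  ∈-ints⁺ (+ zero) zero _ = here refl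
  ∈-ints⁺ x (suc n) ∣x∣≤n with ℕ.m≤n⇒m<n∨m≡n ∣x∣≤n
  ... | inj₁ (s≤s ∣x∣≤n) = there (there (∈-ints⁺ x n ∣x∣≤n))
  ∈-ints⁺ (+ .(suc n)) (suc n) _ | inj₂ refl = here refl
  ∈-ints⁺ -[1+ n ] (suc n) _ | inj₂ refl = there (here refl)

  ∈-ints⁻ : ∀ {x} n → x ∈ ints n → ∣ x ∣ ≤ n
  ∈-ints⁻ zero (here refl) = z≤n
  ∈-ints⁻ (suc n) (here refl) = ℕ.≤-refl
  ∈-ints⁻ (suc n) (there (here refl)) = ℕ.≤-refl
  ∈-ints⁻ (suc n) (there (there x∈)) = ℕ.m≤n⇒m≤1+n (∈-ints⁻ n x∈)

  unique-ints : ∀ n → Unique (ints n)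
  unique-ints zero = [] ∷ []
  unique-ints (suc n) = ((λ ()) ∷ large) ∷ large′ ∷ unique-ints n
    where
    large : All (+ suc n ≢_) (ints n)
    large = All.tabulate λ { x∈ refl → ℕ.1+n≰n (∈-ints⁻ n x∈) }
    large′ : All (-[1+ n ] ≢_) (ints n)
    large′ = All.tabulate λ { x∈ refl → ℕ.1+n≰n (∈-ints⁻ n x∈) }

  -- The bound is separate from the value so that it can run along with the truncation index of `φ`.
  -- In `roots` the bound `m` suffices because an integer is at most its square in absolute value.
  rootsUpTo : ℕ → ℕ → List ℤ
  rootsUpTo b m = filter (λ x → square x ℕ.≟ m) (ints b)

  roots : ℕ → List ℤ
  roots m = rootsUpTo m m

  m≤m*m : ∀ m → m ≤ m ℕ.* m
  m≤m*m zero = z≤n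
  m≤m*m (suc m) = ℕ.m≤m*n (suc m) (suc m)

  enumerates-roots : Enumerates roots square
  enumerates-roots = record
    { unique = λ m → Unique.filter⁺ _ (unique-ints m)
    ; sound = λ {_} {m} x∈ → proj₂ (∈-filter⁻ (λ x → square x ℕ.≟ m) {xs = ints m} x∈)
    ; complete = λ x → ∈-filter⁺ _ (∈-ints⁺ x _ (m≤m*m ∣ x ∣)) refl }

  sign-+ : ∀ a b → sign (a ℕ.+ b) ≡ sign a ℤ.* sign b
  sign-+ zero b = sym (ℤ.*-identityˡ _)
  sign-+ (suc a) b = trans (cong ℤ.-_ (sign-+ a b)) (ℤ.neg-distribˡ-* (sign a) (sign b))

  sign-*-self : ∀ n → sign n ℤ.* sign n ≡ + 1
  sign-*-self zero = refl
  sign-*-self (suc n) = trans (ℤS.solve 1 (λ s → ℤS.:- s ℤS.:* (ℤS.:- s) ℤS.:= s ℤS.:* s) refl (sign n))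
    (sign-*-self n)

  -- Turns the sign (-1)ʲ of the theta series into a function of the exponent j², so that the sign
  -- can be pulled out of a whole coefficient.
  sign-square : ∀ n → sign (n ℕ.* n) ≡ sign n
  sign-square zero = refl
  sign-square (suc n) = cong ℤ.-_ (begin
    sign (n ℕ.+ n ℕ.* suc n)              ≡⟨ cong (λ z → sign (n ℕ.+ z)) (ℕ.*-suc n n) ⟩
    sign (n ℕ.+ (n ℕ.+ n ℕ.* n))          ≡⟨ sign-+ n _ ⟩
    sign n ℤ.* sign (n ℕ.+ n ℕ.* n)       ≡⟨ cong (sign n ℤ.*_) (sign-+ n (n ℕ.* n)) ⟩
    sign n ℤ.* (sign n ℤ.* sign (n ℕ.* n)) ≡⟨ ℤ.*-assoc (sign n) (sign n) _ ⟨
    sign n ℤ.* sign n ℤ.* sign (n ℕ.* n)  ≡⟨ cong₂ ℤ._*_ (sign-*-self n) (sign-square n) ⟩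
    + 1 ℤ.* sign n                        ≡⟨ ℤ.*-identityˡ (sign n) ⟩
    sign n ∎)
    where open ≡-Reasoning

  X^-self : ∀ k → X^ k k ≡ + 1
  X^-self zero = refl
  X^-self (suc k) = X^-self k

  X^-other : ∀ k n → k ≢ n → X^ k n ≡ + 0
  X^-other zero zero k≢n = contradiction refl k≢n
  X^-other zero (suc n) _ = refl
  X^-other (suc k) zero _ = refl
  X^-other (suc k) (suc n) k≢n = X^-other k n (k≢n ∘ cong suc)

  -- The new term of `φ (suc b)` carries the coefficient 2 for the two new candidates b + 1 and -(b
  -- + 1), which enter the list together or not at all.
  φ-roots : ∀ b m → φ b m ≡ sign m ℤ.* + length (rootsUpTo b m)
  φ-roots zero zero = refl
  φ-roots zero (suc m) = sym (ℤ.*-zeroʳ (sign (suc m)))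
  φ-roots (suc b) m = trans (⊕-at (φ b) _ m)
    (trans (cong₂ ℤ._+_ (φ-roots b m)
    (trans (const-⊛ (+ 2) (sgn (suc b) ⊛ X^ N) m) (cong (+ 2 ℤ.*_) (const-⊛ (sign (suc b)) (X^ N) m)))) count)
    where
    N = suc b ℕ.* suc b
    count : sign m ℤ.* + length (rootsUpTo b m) ℤ.+ + 2 ℤ.* (sign (suc b) ℤ.* X^ N m)
      ≡ sign m ℤ.* + length (rootsUpTo (suc b) m)
    count with N ℕ.≟ m
    ... | yes refl rewrite X^-self N | List.filter-accept (λ x → square x ℕ.≟ N) {+ suc b} { -[1+ b ] ∷ ints b} refl
             | List.filter-accept (λ x → square x ℕ.≟ N) { -[1+ b ]} {ints b} refl | sign-square (suc b) =
      ℤS.solve 2 (λ s l → s ℤS.:* l ℤS.:+ ℤS.con (+ 2) ℤS.:* (s ℤS.:* ℤS.con (+ 1)) ℤS.:= s ℤS.:*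
        (ℤS.con (+ 2) ℤS.:+ l)) refl (sign (suc b)) (+ length (rootsUpTo b N))
    ... | no N≢m rewrite X^-other N m N≢m
             | List.filter-reject (λ x → square x ℕ.≟ m) {+ suc b} { -[1+ b ] ∷ ints b} N≢m
             | List.filter-reject (λ x → square x ℕ.≟ m) { -[1+ b ]} {ints b} N≢m =
      ℤS.solve 2 (λ s l → l ℤS.:+ ℤS.con (+ 2) ℤS.:* (s ℤS.:* ℤS.con (+ 0)) ℤS.:= l) refl (sign (suc b))
        (sign m ℤ.* + length (rootsUpTo b m))

  -- The substitution of -X for X, hence compatible with products.
  alternate : Series → Series
  alternate f n = sign n ℤ.* f n

  alternate-⊛ : ∀ f g n → (alternate f ⊛ alternate g) n ≡ sign n ℤ.* (f ⊛ g) n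
  alternate-⊛ f g n = go 0 f n
    where
    -- The recursion of `_⊛_` shifts the left factor but not its signs, so the offset `k` records
    -- where they start.
    go : ∀ k f n → ((λ i → sign (k ℕ.+ i) ℤ.* f i) ⊛ alternate g) n ≡ sign (k ℕ.+ n) ℤ.* (f ⊛ g) n
    go k f zero = ℤS.solve 3 (λ s a b → s ℤS.:* a ℤS.:* (ℤS.con (+ 1) ℤS.:* b) ℤS.:= s ℤS.:* (a ℤS.:* b)) refl
      (sign (k ℕ.+ 0)) (f 0) (g 0)
    go k f (suc n) = trans (cong₂ ℤ._+_ head tail) (sym (ℤ.*-distribˡ-+ (sign (k ℕ.+ suc n)) (f 0 ℤ.* g (suc n)) _))
      where
      head : sign (k ℕ.+ 0) ℤ.* f 0 ℤ.* (sign (suc n) ℤ.* g (suc n)) ≡ sign (k ℕ.+ suc n) ℤ.* (f 0 ℤ.* g (suc n))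
      head rewrite ℕ.+-identityʳ k | sign-+ k (suc n) =
        ℤS.solve 4 (λ s a t b → s ℤS.:* a ℤS.:* (t ℤS.:* b) ℤS.:= s ℤS.:* t ℤS.:* (a ℤS.:* b)) refl (sign k) (f 0)
        (sign (suc n)) (g (suc n))
      tail : ((λ i → sign (k ℕ.+ suc i) ℤ.* f (suc i)) ⊛ alternate g) n ≡ sign (k ℕ.+ suc n) ℤ.* (f ∘ suc ⊛ g) n
      tail = trans (⊛-local n (λ i _ → cong (λ j → sign j ℤ.* f (suc i)) (ℕ.+-suc k i)) (λ _ _ → refl))
        (trans (go (suc k) (f ∘ suc) n) (cong (λ j → sign j ℤ.* (f ∘ suc ⊛ g) n) (sym (ℕ.+-suc k n))))

  reps₂ : ℕ → List (ℤ × ℤ)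
  reps₂ = conv roots roots

  reps₃ : ℕ → List (ℤ × ℤ × ℤ)
  reps₃ = conv roots reps₂

  reps₄ : ℕ → List (ℤ × ℤ × ℤ × ℤ)
  reps₄ = conv roots reps₃

  norm₃ : ℤ × ℤ × ℤ → ℕ
  norm₃ (a , b , c) = square a ℕ.+ (square b ℕ.+ square c)

  norm₄ : ℤ × ℤ × ℤ × ℤ → ℕ
  norm₄ (a , b , c , d) = square a ℕ.+ norm₃ (b , c , d)

  enumerates₃ : Enumerates reps₃ norm₃
  enumerates₃ = enumerates-conv enumerates-roots (enumerates-conv enumerates-roots enumerates-roots)

  enumerates₄ : Enumerates reps₄ norm₄
  enumerates₄ = enumerates-conv enumerates-roots enumerates₃

  alternate-cong : ∀ {f g} → f ≈ g → alternate f ≈ alternate g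
  alternate-cong p = pointwise λ n → cong (sign n ℤ.*_) (at p n)

  φ∞-roots : φ∞ ≈ alternate (card roots)
  φ∞-roots = pointwise λ n → φ-roots n n

  power-step : {F : ℕ → List A} {f : Series} → f ≈ alternate (card F) → φ∞ ⊛ f ≈ alternate (card (conv roots F))
  power-step {F = F} p = ≈-trans (⊛-cong φ∞-roots p) (≈-trans (pointwise (alternate-⊛ (card roots) (card F)))
    (alternate-cong (≈-sym (pointwise (card-conv roots F)))))

  φ³ : φ∞ ⊛ (φ∞ ⊛ φ∞) ≈ alternate (card reps₃)
  φ³ = power-step (power-step φ∞-roots)

  φ⁴ : φ∞ ⊛ (φ∞ ⊛ (φ∞ ⊛ φ∞)) ≈ alternate (card reps₄)
  φ⁴ = power-step φ³

-- Integral quaternions of norm divisible by 7, and r₄(7n) modulo 7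

module Quaternions where

  open Frobenius
  open SumsOfSquares
  open ℤS using (solve; _:+_; _:*_; _:-_; :-_; _:=_; Polynomial)
  open import Data.Integer using (_+_; _*_; _-_; -_)
  open import Data.Integer.Divisibility.Signed using (_∣_; _∣?_)

  private variable A B : Set

  ℍ : Set
  ℍ = ℤ × ℤ × ℤ × ℤ

  infixl 7 _·_
  _·_ : ℍ → ℍ → ℍ
  (a , b , c , d) · (s , t , u , v) =
      a * s + - (b * t) + - (c * u) + - (d * v)
    , a * t + b * s + c * v + - (d * u)
    , a * u + - (b * v) + c * s + d * t
    , a * v + b * u + - (c * t) + d * s

  conj : ℍ → ℍ
  conj (a , b , c , d) = a , - b , - c , - d

  normℤ : ℍ → ℤ
  normℤ (a , b , c , d) = a * a + (b * b + (c * c + d * d))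

  scale : ℤ → ℍ → ℍ
  scale k (a , b , c , d) = k * a , k * b , k * c , k * d

  quad : ∀ {a a′ b b′ c c′ d d′ : ℤ} → a ≡ a′ → b ≡ b′ → c ≡ c′ → d ≡ d′ → (a , b , c , d) ≡ (a′ , b′ , c′ , d′)
  quad refl refl refl refl = refl

  -- The quaternion operations repeated on solver syntax: each quaternion identity below is written
  -- once and then projected to its four coordinates.
  module _ {n : ℕ} where
    infixl 7 _·ᵖ_
    ℍᵖ : Set
    ℍᵖ = Polynomial n × Polynomial n × Polynomial n × Polynomial n

    _·ᵖ_ : ℍᵖ → ℍᵖ → ℍᵖ
    (a , b , c , d) ·ᵖ (s , t , u , v) =
        a :* s :+ :- (b :* t) :+ :- (c :* u) :+ :- (d :* v)
      , a :* t :+ b :* s :+ c :* v :+ :- (d :* u)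
      , a :* u :+ :- (b :* v) :+ c :* s :+ d :* t
      , a :* v :+ b :* u :+ :- (c :* t) :+ d :* s

    conjᵖ : ℍᵖ → ℍᵖ
    conjᵖ (a , b , c , d) = a , :- b , :- c , :- d

    normᵖ : ℍᵖ → Polynomial n
    normᵖ (a , b , c , d) = a :* a :+ (b :* b :+ (c :* c :+ d :* d))

    scaleᵖ : Polynomial n → ℍᵖ → ℍᵖ
    scaleᵖ k (a , b , c , d) = k :* a , k :* b , k :* c , k :* d

    re im₁ im₂ im₃ : ℍᵖ → Polynomial n
    re (a , _) = a
    im₁ (_ , b , _) = b
    im₂ (_ , _ , c , _) = c
    im₃ (_ , _ , _ , d) = d

  ·-conj : ∀ x y → (x · y) · conj y ≡ scale (normℤ y) x
  ·-conj (a , b , c , d) (s , t , u , v) = quad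
    (solve 8 (λ a b c d s t u v → let x = (a , b , c , d) ; y = (s , t , u , v) in
      re ((x ·ᵖ y) ·ᵖ conjᵖ y) := re (scaleᵖ (normᵖ y) x)) refl a b c d s t u v)
    (solve 8 (λ a b c d s t u v → let x = (a , b , c , d) ; y = (s , t , u , v) in
      im₁ ((x ·ᵖ y) ·ᵖ conjᵖ y) := im₁ (scaleᵖ (normᵖ y) x)) refl a b c d s t u v)
    (solve 8 (λ a b c d s t u v → let x = (a , b , c , d) ; y = (s , t , u , v) in
      im₂ ((x ·ᵖ y) ·ᵖ conjᵖ y) := im₂ (scaleᵖ (normᵖ y) x)) refl a b c d s t u v)
    (solve 8 (λ a b c d s t u v → let x = (a , b , c , d) ; y = (s , t , u , v) in
      im₃ ((x ·ᵖ y) ·ᵖ conjᵖ y) := im₃ (scaleᵖ (normᵖ y) x)) refl a b c d s t u v)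

  conj-conj : ∀ x → conj (conj x) ≡ x
  conj-conj (a , b , c , d) = quad refl (ℤ.neg-involutive b) (ℤ.neg-involutive c) (ℤ.neg-involutive d)

  normℤ-conj : ∀ x → normℤ (conj x) ≡ normℤ x
  normℤ-conj (a , b , c , d) =
    solve 4 (λ a b c d → let x = (a , b , c , d) in normᵖ (conjᵖ x) := normᵖ x) refl a b c d

  conj-· : ∀ x y → (x · conj y) · y ≡ scale (normℤ y) x
  conj-· x y = trans (cong ((x · conj y) ·_) (sym (conj-conj y)))
    (trans (·-conj x (conj y)) (cong (λ k → scale k x) (normℤ-conj y)))

  -- Euler's four-square identity.
  normℤ-· : ∀ x y → normℤ (x · y) ≡ normℤ x * normℤ y
  normℤ-· (a , b , c , d) (s , t , u , v) = solve 8 (λ a b c d s t u v →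
    let x = (a , b , c , d) ; y = (s , t , u , v) in normᵖ (x ·ᵖ y) := normᵖ x :* normᵖ y) refl a b c d s t u v

  scale-· : ∀ k x y → scale k x · y ≡ scale k (x · y)
  scale-· k (a , b , c , d) (s , t , u , v) = quad
    (solve 9 (λ k a b c d s t u v → let x = (a , b , c , d) ; y = (s , t , u , v) in
      re (scaleᵖ k x ·ᵖ y) := re (scaleᵖ k (x ·ᵖ y))) refl k a b c d s t u v)
    (solve 9 (λ k a b c d s t u v → let x = (a , b , c , d) ; y = (s , t , u , v) in
      im₁ (scaleᵖ k x ·ᵖ y) := im₁ (scaleᵖ k (x ·ᵖ y))) refl k a b c d s t u v)
    (solve 9 (λ k a b c d s t u v → let x = (a , b , c , d) ; y = (s , t , u , v) in
      im₂ (scaleᵖ k x ·ᵖ y) := im₂ (scaleᵖ k (x ·ᵖ y))) refl k a b c d s t u v)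
    (solve 9 (λ k a b c d s t u v → let x = (a , b , c , d) ; y = (s , t , u , v) in
      im₃ (scaleᵖ k x ·ᵖ y) := im₃ (scaleᵖ k (x ·ᵖ y))) refl k a b c d s t u v)

  scale-7-injective : ∀ {x y} → scale (+ 7) x ≡ scale (+ 7) y → x ≡ y
  scale-7-injective {_ , _ , _ , _} {_ , _ , _ , _} eq = quad
    (cancel (cong proj₁ eq)) (cancel (cong (proj₁ ∘ proj₂) eq)) (cancel (cong (proj₁ ∘ proj₂ ∘ proj₂) eq))
      (cancel (cong (proj₂ ∘ proj₂ ∘ proj₂) eq))
    where
    cancel : ∀ {a b} → + 7 * a ≡ + 7 * b → a ≡ b
    cancel = ℤ.*-cancelˡ-≡ (+ 7) _ _

  square-ℤ : ∀ x → + square x ≡ x * x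
  square-ℤ (+ n) = ℤ.pos-* n n
  square-ℤ -[1+ n ] = refl

  norm₄-ℤ : ∀ x → + norm₄ x ≡ normℤ x
  norm₄-ℤ (a , b , c , d) = cong₂ _+_ (square-ℤ a) (cong₂ _+_ (square-ℤ b) (cong₂ _+_ (square-ℤ c) (square-ℤ d)))

  7∣ : ℍ → Set
  7∣ (a , b , c , d) = + 7 ∣ a × + 7 ∣ b × + 7 ∣ c × + 7 ∣ d

  7∣? : ∀ x → Dec (7∣ x)
  7∣? (a , b , c , d) = + 7 ∣? a ×-dec + 7 ∣? b ×-dec + 7 ∣? c ×-dec + 7 ∣? d

  7∣-scale : ∀ x → 7∣ (scale (+ 7) x)
  7∣-scale (a , b , c , d) = f a , f b , f c , f d
    where
    f : ∀ a → + 7 ∣ + 7 * a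
    f a = divides a (ℤ.*-comm (+ 7) a)

  7∣⇒scale : ∀ x → 7∣ x → ∃ λ y → x ≡ scale (+ 7) y
  7∣⇒scale x (divides a p , divides b q , divides c r , divides d s) =
    (a , b , c , d) , quad (trans p (ℤ.*-comm a (+ 7))) (trans q (ℤ.*-comm b (+ 7))) (trans r (ℤ.*-comm c (+ 7)))
      (trans s (ℤ.*-comm d (+ 7)))

  -- Since conj π · π = 7, this decides whether x is a left multiple of π.
  _∈ℍ?_ : ∀ x π → Dec (7∣ (x · conj π))
  x ∈ℍ? π = 7∣? (x · conj π)

  module _ (π : ℍ) (norm-π : normℤ π ≡ + 7) where

    ·π-injective : ∀ {x y} → x · π ≡ y · π → x ≡ y
    ·π-injective {x} {y} eq = scale-7-injective (trans (sym (back x)) (trans (cong (_· conj π) eq) (back y)))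
      where
      back : ∀ x → (x · π) · conj π ≡ scale (+ 7) x
      back x = trans (·-conj x π) (cong (λ k → scale k x) norm-π)

    norm₄-·π : ∀ x → norm₄ (x · π) ≡ norm₄ x ℕ.* 7
    norm₄-·π x = ℤ.+-injective (begin
      + norm₄ (x · π)        ≡⟨ norm₄-ℤ (x · π) ⟩
      normℤ (x · π)          ≡⟨ normℤ-· x π ⟩
      normℤ x * normℤ π      ≡⟨ cong₂ _*_ (sym (norm₄-ℤ x)) norm-π ⟩
      + norm₄ x * + 7        ≡⟨ ℤ.pos-* (norm₄ x) 7 ⟨
      + (norm₄ x ℕ.* 7)      ∎)
      where open ≡-Reasoning

    -- Right multiplication by π multiplies the norm by 7 and is a bijection from the quaternions of
    -- norm `n` to the left multiples of π of norm 7n.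
    multiples-count : ∀ n → length (filter (_∈ℍ? π) (reps₄ (n ℕ.* 7))) ≡ length (reps₄ n)
    multiples-count n = sym (bijection-length {xs = reps₄ n} {filter (_∈ℍ? π) (reps₄ (n ℕ.* 7))} (_· π) ·π-injective
      (unique enumerates₄ n) (Unique.filter⁺ (_∈ℍ? π) (unique enumerates₄ (n ℕ.* 7)))
      (λ {x} x∈ → ∈-filter⁺ (_∈ℍ? π) {xs = reps₄ (n ℕ.* 7)}
        (subst (λ k → x · π ∈ reps₄ k) (trans (norm₄-·π x) (cong (ℕ._* 7) (sound enumerates₄ {n = n} x∈)))
          (complete enumerates₄ (x · π)))
        (subst 7∣ (sym (trans (·-conj x π) (cong (λ k → scale k x) norm-π))) (7∣-scale x)))
      surjective)
      where
      surjective : ∀ {x} → x ∈ filter (_∈ℍ? π) (reps₄ (n ℕ.* 7)) → ∃ λ y → y ∈ reps₄ n × x ≡ y · π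
      surjective {x} x∈ with x∈reps , 7∣xπ̄ ← ∈-filter⁻ (_∈ℍ? π) {xs = reps₄ (n ℕ.* 7)} x∈
        -- The quotient is x · conj π divided by 7; membership in the filtered list says exactly
        -- that it is integral.
        with y , eq ← 7∣⇒scale (x · conj π) 7∣xπ̄ =
        y , subst (λ k → y ∈ reps₄ k) (ℕ.*-cancelʳ-≡ (norm₄ y) n 7
          (trans (sym (norm₄-·π y)) (trans (cong norm₄ (sym x≡yπ)) (sound enumerates₄ x∈reps))))
          (complete enumerates₄ y) , x≡yπ
        where
        x≡yπ : x ≡ y · π
        x≡yπ = scale-7-injective (begin
          scale (+ 7) x          ≡⟨ cong (λ k → scale k x) norm-π ⟨
          scale (normℤ π) x      ≡⟨ conj-· x π ⟨
          (x · conj π) · π       ≡⟨ cong (_· π) eq ⟩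
          scale (+ 7) y · π      ≡⟨ scale-· (+ 7) y π ⟩
          scale (+ 7) (y · π)    ∎)
          where open ≡-Reasoning

  -- The Lipschitz quaternions of norm 7 up to left multiplication by units
  primes₇ : List ℍ
  primes₇ =
      (+ 2 , + 1 , + 1 , + 1) ∷ (+ 2 , + 1 , + 1 , - + 1)
    ∷ (+ 2 , + 1 , - + 1 , + 1) ∷ (+ 2 , + 1 , - + 1 , - + 1)
    ∷ (+ 2 , - + 1 , + 1 , + 1) ∷ (+ 2 , - + 1 , + 1 , - + 1)
    ∷ (+ 2 , - + 1 , - + 1 , + 1) ∷ (+ 2 , - + 1 , - + 1 , - + 1) ∷ []

  rightDivisors : ℍ → ℕ
  rightDivisors x = length (filter (x ∈ℍ?_) primes₇)

  residue : Fin 7 → ℤ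
  residue r = + toℕ r

  -- Modulo 7 the quaternions form the 2 by 2 matrices over the field of 7 elements, with the norm
  -- as determinant, and the eight π generate the eight proper nonzero left ideals. A singular
  -- nonzero matrix lies in exactly one of these, zero in all eight, and 8 ≡ 1. The proof evaluates
  -- all 7⁴ residues.
  rightDivisors-residue : ∀ a b c d → let x = (residue a , residue b , residue c , residue d) in
    + 7 ∣ normℤ x → + 7 ∣ + rightDivisors x - + 1
  rightDivisors-residue = toWitness {a? = all? λ a → all? λ b → all? λ c → all? λ d →
    let x = (residue a , residue b , residue c , residue d) in
    (+ 7 ∣? normℤ x) →-dec (+ 7 ∣? (+ rightDivisors x - + 1))} _

  residueOf : ℤ → Fin 7
  residueOf a = fromℕ< (n%ℕd<d a 7)

  ≡₇-residue : ∀ a → a ≡₇ residue (residueOf a)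
  ≡₇-residue a = mod₇ (divides (a /ℕ 7) (begin
    a - residue (residueOf a)
      ≡⟨ cong₂ (λ x r → x - + r) (a≡a%ℕn+[a/ℕn]*n a 7) (toℕ-fromℕ< (n%ℕd<d a 7)) ⟩
    + (a %ℕ 7) + (a /ℕ 7) * + 7 - + (a %ℕ 7)
      ≡⟨ solve 2 (λ r q → r :+ q :- r := q) refl (+ (a %ℕ 7)) ((a /ℕ 7) * + 7) ⟩
    (a /ℕ 7) * + 7                                  ∎))
    where open ≡-Reasoning

  -‿cong₇ : ∀ {a b} → a ≡₇ b → - a ≡₇ - b
  -‿cong₇ {a} {b} p = ≡₇-trans (≡₇-reflexive (sym (ℤ.-1*i≡-i a)))
    (≡₇-trans (*-cong₇ {ℤ.-1ℤ} (≡₇-reflexive refl) p) (≡₇-reflexive (ℤ.-1*i≡-i b)))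

  ∣-resp-≡₇ : ∀ {a b} → a ≡₇ b → + 7 ∣ a → + 7 ∣ b
  ∣-resp-≡₇ {a} {b} p q = subst (+ 7 ∣_) (solve 2 (λ a b → b :- a :+ a := b) refl a b) (∣m∣n⇒∣m+n (7∣- (≡₇-sym p)) q)

  infix 4 _≈₇_
  _≈₇_ : ℍ → ℍ → Set
  (a , b , c , d) ≈₇ (a′ , b′ , c′ , d′) = a ≡₇ a′ × b ≡₇ b′ × c ≡₇ c′ × d ≡₇ d′

  ·-congʳ₇ : ∀ {x y} z → x ≈₇ y → x · z ≈₇ y · z
  ·-congʳ₇ {a , b , c , d} {a′ , b′ , c′ , d′} (s , t , u , v) (p , q , r , w) =
      p ⊗ s ⊞ -‿cong₇ (q ⊗ t) ⊞ -‿cong₇ (r ⊗ u) ⊞ -‿cong₇ (w ⊗ v)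
    , p ⊗ t ⊞ q ⊗ s ⊞ r ⊗ v ⊞ -‿cong₇ (w ⊗ u)
    , p ⊗ u ⊞ -‿cong₇ (q ⊗ v) ⊞ r ⊗ s ⊞ w ⊗ t
    , p ⊗ v ⊞ q ⊗ u ⊞ -‿cong₇ (r ⊗ t) ⊞ w ⊗ s
    where
    infixl 6 _⊞_
    infixl 7 _⊗_
    _⊞_ : ∀ {a a′ b b′} → a ≡₇ a′ → b ≡₇ b′ → a + b ≡₇ a′ + b′
    _⊞_ = +-cong₇
    _⊗_ : ∀ {a a′} → a ≡₇ a′ → ∀ k → a * k ≡₇ a′ * k
    p ⊗ k = *-cong₇ p (≡₇-reflexive refl)

  normℤ-cong₇ : ∀ {x y} → x ≈₇ y → normℤ x ≡₇ normℤ y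
  normℤ-cong₇ (p , q , r , s) = +-cong₇ (*-cong₇ p p) (+-cong₇ (*-cong₇ q q) (+-cong₇ (*-cong₇ r r) (*-cong₇ s s)))

  7∣-resp : ∀ {x y} → x ≈₇ y → 7∣ x → 7∣ y
  7∣-resp (p , q , r , s) (a , b , c , d) = ∣-resp-≡₇ p a , ∣-resp-≡₇ q b , ∣-resp-≡₇ r c , ∣-resp-≡₇ s d

  ≈₇-sym : ∀ {x y} → x ≈₇ y → y ≈₇ x
  ≈₇-sym (p , q , r , s) = ≡₇-sym p , ≡₇-sym q , ≡₇-sym r , ≡₇-sym s

  -- Divisibility by 7 of the norm and of each x · conj π depends only on the residues of the
  -- coordinates, so the finite check applies.
  rightDivisors-≡₇ : ∀ x n → norm₄ x ≡ n ℕ.* 7 → + rightDivisors x ≡₇ + 1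
  rightDivisors-≡₇ x@(a , b , c , d) n norm≡ = subst (λ k → + k ≡₇ + 1) (sym same)
    (mod₇ (rightDivisors-residue (residueOf a) (residueOf b) (residueOf c) (residueOf d) (∣-resp-≡₇ (normℤ-cong₇ x≈r)
      (divides (+ n) (trans (sym (norm₄-ℤ x)) (trans (cong +_ norm≡) (ℤ.pos-* n 7)))))))
    where
    r : ℍ
    r = residue (residueOf a) , residue (residueOf b) , residue (residueOf c) , residue (residueOf d)
    x≈r : x ≈₇ r
    x≈r = ≡₇-residue a , ≡₇-residue b , ≡₇-residue c , ≡₇-residue d
    same : rightDivisors x ≡ rightDivisors r
    same = cong length (List.filter-≐ (x ∈ℍ?_) (r ∈ℍ?_)
      ((λ {π} → 7∣-resp (·-congʳ₇ {x} {r} (conj π) x≈r)) ,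
        (λ {π} → 7∣-resp (·-congʳ₇ {r} {x} (conj π) (≈₇-sym {x} {r} x≈r)))) primes₇)

  double-count : {R : A → B → Set} (R? : Decidable R) (xs : List A) (ys : List B) →
    sum (map (λ x → length (filter (R? x) ys)) xs) ≡ sum (map (λ y → length (filter (λ x → R? x y) xs)) ys)
  double-count R? [] ys = sym (zeros ys)
    where
    zeros : (ys : List B) → sum (map (λ _ → 0) ys) ≡ 0
    zeros [] = refl
    zeros (y ∷ ys) = zeros ys
  double-count {B = B} R? (x ∷ xs) ys = trans (cong (length (filter (R? x) ys) ℕ.+_) (double-count R? xs ys)) (add ys)
    where
    add : ∀ ys → length (filter (R? x) ys) ℕ.+ sum (map (λ y → length (filter (λ x → R? x y) xs)) ys)
      ≡ sum (map (λ y → length (filter (λ x → R? x y) (x ∷ xs))) ys)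
    add [] = refl
    add (y ∷ ys) with ih ← trans (x∙yz≈y∙xz (length (filter (R? x) ys)) (length (filter (λ x → R? x y) xs)) _)
      (cong (length (filter (λ x → R? x y) xs) ℕ.+_) (add ys)) | R? x y
    ... | yes _ = cong suc ih
    ... | no _ = ih

  sum-ones₇ : (f : A → ℕ) (xs : List A) → (∀ {x} → x ∈ xs → + f x ≡₇ + 1) → + sum (map f xs) ≡₇ + length xs
  sum-ones₇ f [] _ = ≡₇-reflexive refl
  sum-ones₇ f (x ∷ xs) p = +-cong₇ (p (here refl)) (sum-ones₇ f xs (λ x∈ → p (there x∈)))

  sum-const : (f : A → ℕ) (k : ℕ) (xs : List A) → All (λ x → f x ≡ k) xs → sum (map f xs) ≡ length xs ℕ.* k
  sum-const f k [] [] = refl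
  sum-const f k (x ∷ xs) (p ∷ ps) = cong₂ ℕ._+_ p (sum-const f k xs ps)

  norm-primes₇ : All (λ π → normℤ π ≡ + 7) primes₇
  norm-primes₇ = refl ∷ refl ∷ refl ∷ refl ∷ refl ∷ refl ∷ refl ∷ refl ∷ []

  reps₄-section : ∀ n → + length (reps₄ (n ℕ.* 7)) ≡₇ + length (reps₄ n)
  reps₄-section n = ≡₇-trans
    (≡₇-sym (sum-ones₇ rightDivisors (reps₄ (n ℕ.* 7)) λ {x} x∈ → rightDivisors-≡₇ x n (sound enumerates₄ x∈)))
    (≡₇-trans (≡₇-reflexive (cong +_ (trans (double-count _∈ℍ?_ (reps₄ (n ℕ.* 7)) primes₇)
      (sum-const _ (length (reps₄ n)) primes₇ (All.map (λ {π} norm-π → multiples-count π norm-π n) norm-primes₇)))))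
    -- Eight divisors contribute r₄(n) each, and 8 r₄(n) unfolds to r₄(n) + 7 r₄(n).
    (≡₇-trans (+-cong₇ (≡₇-reflexive {+ length (reps₄ n)} refl)
      (≡₇-trans (≡₇-reflexive {+ (7 ℕ.* length (reps₄ n))} (ℤ.pos-* 7 (length (reps₄ n))))
      (7*≡₇0 (+ length (reps₄ n)))))
      (≡₇-reflexive (ℤ.+-identityʳ _))))

-- Overpartition triples at multiples of 7, and sums of three squares

module Overpartitions where

  open PowerSeries
  open GaussTheta using (cast; sign; φ∞; gauss)
  open Frobenius
  open SumsOfSquares
  open Quaternions using (reps₄-section)
  open import Data.Integer using (∣_∣)

  -- The accumulator adds summands at its upper end while `_⊛_` peels them off at the lower end; `c`
  -- collects those already peeled.
  go-⊛ : ∀ n f g c (go : ℕ → ℕ) → go 0 ≡ c ℕ.+ f 0 ℕ.* g n →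
    (∀ a → go (suc a) ≡ go a ℕ.+ f (suc a) ℕ.* g (n ∸ suc a)) →
    + go n ≡ + c ℤ.+ (cast f ⊛ cast g) n
  go-⊛ zero f g c go base step = trans (cong +_ base) (cong (λ z → + c ℤ.+ z) (ℤ.pos-* (f 0) (g 0)))
  go-⊛ (suc n) f g c go base step = trans
    (go-⊛ n (f ∘ suc) g (c ℕ.+ f 0 ℕ.* g (suc n)) (go ∘ suc) (trans (step 0) (cong (ℕ._+ f 1 ℕ.* g n) base))
      (step ∘ suc))
    (trans (cong (λ z → + c ℤ.+ z ℤ.+ (cast (f ∘ suc) ⊛ cast g) n) (ℤ.pos-* (f 0) (g (suc n))))
      (ℤ.+-assoc (+ c) (+ f 0 ℤ.* + g (suc n)) ((cast (f ∘ suc) ⊛ cast g) n)))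

  -- The accumulators of pbar2 and pbar3 are local, hence nameless; abstracting suc a makes the
  -- two occurrences of the index independent variables, so that unification can name them.
  mutual
    go₂ : ℕ → ℕ → ℕ
    go₂ = _

    unfold₂ : ∀ a → pbar2 (suc a) ≡ go₂ (suc a) a ℕ.+ pbar (suc a) ℕ.* pbar (suc a ∸ suc a)
    unfold₂ a with suc a
    ... | w = refl

  mutual
    go₃ : ℕ → ℕ → ℕ
    go₃ = _

    unfold₃ : ∀ a → pbar3 (suc a) ≡ go₃ (suc a) a ℕ.+ pbar (suc a) ℕ.* pbar2 (suc a ∸ suc a)
    unfold₃ a with suc a
    ... | w = refl

  pbar2-⊛ : cast pbar2 ≈ cast pbar ⊛ cast pbar
  pbar2-⊛ = pointwise λ n → trans (go-⊛ n pbar pbar 0 (go₂ n) refl (λ _ → refl)) (ℤ.+-identityˡ _)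

  pbar3-⊛ : cast pbar3 ≈ cast pbar ⊛ (cast pbar ⊛ cast pbar)
  pbar3-⊛ = ≈-trans (pointwise λ n → trans (go-⊛ n pbar pbar2 0 (go₃ n) refl (λ _ → refl)) (ℤ.+-identityˡ _))
    (⊛-cong ≈-refl pbar2-⊛)

  sign-*7 : ∀ n → sign (n ℕ.* 7) ≡ sign n
  sign-*7 zero = refl
  sign-*7 (suc n) = cong ℤ.-_ (trans (ℤ.neg-involutive _)
    (trans (ℤ.neg-involutive _) (trans (ℤ.neg-involutive _) (sign-*7 n))))

  sign-*4 : ∀ n → sign (n ℕ.* 4) ≡ + 1
  sign-*4 zero = refl
  sign-*4 (suc n) = trans (ℤ.neg-involutive _) (trans (ℤ.neg-involutive _) (sign-*4 n))

  φ⁴-section : ∀ n → section (φ∞ ⊛ (φ∞ ⊛ (φ∞ ⊛ φ∞))) n ≡₇ (φ∞ ⊛ (φ∞ ⊛ (φ∞ ⊛ φ∞))) n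
  φ⁴-section n = ≡₇-trans (≡₇-reflexive (at φ⁴ (n ℕ.* 7)))
    (≡₇-trans (*-cong₇ (≡₇-reflexive (sign-*7 n)) (reps₄-section n)) (≡₇-reflexive (sym (at φ⁴ n))))

  pbar3-section : ∀ n → + pbar3 (n ℕ.* 7) ≡₇ sign n ℤ.* + length (reps₃ n)
  pbar3-section n = ≡₇-trans (≡₇-reflexive (at pbar3-⊛ (n ℕ.* 7)))
    (≡₇-trans (section-cube (cast pbar) φ∞ gauss φ⁴-section n) (≡₇-reflexive (at φ³ n)))

  square-% : ∀ m d .{{_ : NonZero d}} → (m ℕ.* m) ℕ.% d ≡ ((m ℕ.% d) ℕ.* (m ℕ.% d)) ℕ.% d
  square-% m d = ℕ.%-distribˡ-* m m d

  norm₃-residue : ∀ d .{{_ : NonZero d}} a b c → let a′ = ∣ a ∣ ℕ.% d ; b′ = ∣ b ∣ ℕ.% d ; c′ = ∣ c ∣ ℕ.% d in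
    norm₃ (a , b , c) ℕ.% d ≡ (a′ ℕ.* a′ ℕ.+ (b′ ℕ.* b′ ℕ.+ c′ ℕ.* c′)) ℕ.% d
  norm₃-residue d a b c = +-%-cong (square a) _ (square-% ∣ a ∣ d)
    (+-%-cong (square b) _ (square-% ∣ b ∣ d) (square-% ∣ c ∣ d))
    where
    +-%-cong : ∀ m m′ {n n′} → m ℕ.% d ≡ m′ ℕ.% d → n ℕ.% d ≡ n′ ℕ.% d → (m ℕ.+ n) ℕ.% d ≡ (m′ ℕ.+ n′) ℕ.% d
    +-%-cong m m′ {n} {n′} p q = trans (ℕ.%-distribˡ-+ m n d)
      (trans (cong₂ (λ x y → (x ℕ.+ y) ℕ.% d) p q) (sym (ℕ.%-distribˡ-+ m′ n′ d)))

  squares : ∀ {d} → Fin d → Fin d → Fin d → ℕ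
  squares a b c = toℕ a ℕ.* toℕ a ℕ.+ (toℕ b ℕ.* toℕ b ℕ.+ toℕ c ℕ.* toℕ c)

  -- Squares are 0, 1 or 4 modulo 8, and no three of these add up to 7.
  mod-8 : ∀ (a b c : Fin 8) → squares a b c ℕ.% 8 ≢ 7
  mod-8 = toWitness {a? = all? λ a → all? λ b → all? λ c → ¬? (squares a b c ℕ.% 8 ℕ.≟ 7)} _

  -- Squares are 0 or 1 modulo 4, so three of them add up to 0 only if each is 0.
  mod-4 : ∀ (a b c : Fin 4) → squares a b c ℕ.% 4 ≡ 0 → 2 ℕ.∣ toℕ a × 2 ℕ.∣ toℕ b × 2 ℕ.∣ toℕ c
  mod-4 = toWitness {a? = all? λ a → all? λ b → all? λ c → (squares a b c ℕ.% 4 ℕ.≟ 0) →-dec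
    (2 ℕ.∣? toℕ a ×-dec 2 ℕ.∣? toℕ b ×-dec 2 ℕ.∣? toℕ c)} _

  residue-of : ∀ d .{{_ : NonZero d}} → ℤ → Fin d
  residue-of d a = fromℕ< (ℕ.m%n<n ∣ a ∣ d)

  norm₃-squares : ∀ d .{{_ : NonZero d}} a b c →
    norm₃ (a , b , c) ℕ.% d ≡ squares (residue-of d a) (residue-of d b) (residue-of d c) ℕ.% d
  norm₃-squares d a b c
    rewrite toℕ-fromℕ< (ℕ.m%n<n ∣ a ∣ d) | toℕ-fromℕ< (ℕ.m%n<n ∣ b ∣ d) | toℕ-fromℕ< (ℕ.m%n<n ∣ c ∣ d) =
      norm₃-residue d a b c

  reps₃-8n+7 : ∀ n → length (reps₃ (8 ℕ.* n ℕ.+ 7)) ≡ 0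
  reps₃-8n+7 n with reps₃ (8 ℕ.* n ℕ.+ 7) in eq
  ... | [] = refl
  ... | x@(a , b , c) ∷ _ = contradiction
    (trans (sym (norm₃-squares 8 a b c))
      (trans (cong (ℕ._% 8) (trans (sound enumerates₃ (subst (x ∈_) (sym eq) (here refl))) 8n+7))
      (ℕ.[m+kn]%n≡m%n 7 n 8)))
    (mod-8 (residue-of 8 a) (residue-of 8 b) (residue-of 8 c))
    where
    8n+7 : 8 ℕ.* n ℕ.+ 7 ≡ 7 ℕ.+ n ℕ.* 8
    8n+7 = trans (ℕ.+-comm (8 ℕ.* n) 7) (cong (7 ℕ.+_) (ℕ.*-comm 8 n))

  double : ℤ × ℤ × ℤ → ℤ × ℤ × ℤ
  double (a , b , c) = a ℤ.* + 2 , b ℤ.* + 2 , c ℤ.* + 2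

  double-injective : ∀ {x y} → double x ≡ double y → x ≡ y
  double-injective {a , b , c} {a′ , b′ , c′} eq =
    cong₂ _,_ (cancel (cong proj₁ eq))
    (cong₂ _,_ (cancel (cong (proj₁ ∘ proj₂) eq)) (cancel (cong (proj₂ ∘ proj₂) eq)))
    where
    cancel : ∀ {a b} → a ℤ.* + 2 ≡ b ℤ.* + 2 → a ≡ b
    cancel {a} {b} = ℤ.*-cancelʳ-≡ a b (+ 2)

  norm₃-double : ∀ x → norm₃ (double x) ≡ norm₃ x ℕ.* 4
  norm₃-double (a , b , c) rewrite ℤ.abs-* a (+ 2) | ℤ.abs-* b (+ 2) | ℤ.abs-* c (+ 2) =
    ℕS.solve 3 (λ a b c → (a :* con 2) :* (a :* con 2) :+
      ((b :* con 2) :* (b :* con 2) :+ (c :* con 2) :* (c :* con 2)) :=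
      (a :* a :+ (b :* b :+ c :* c)) :* con 4) refl (∣ a ∣) (∣ b ∣) (∣ c ∣)
    where open ℕS

  even-residue : ∀ a → 2 ℕ.∣ toℕ (residue-of 4 a) → ∃ λ b → a ≡ b ℤ.* + 2
  even-residue a 2∣r with divides q eq ← ∣ᵤ⇒∣ {+ 2} {a} (subst (2 ℕ.∣_) (sym (ℕ.m≡m%n+[m/n]*n ∣ a ∣ 4))
    (ℕ.∣m∣n⇒∣m+n (subst (2 ℕ.∣_) (toℕ-fromℕ< (ℕ.m%n<n ∣ a ∣ 4)) 2∣r) (ℕ.∣n⇒∣m*n (∣ a ∣ ℕ./ 4) (ℕ.divides 2 refl)))) =
      q , eq

  -- Doubling the coordinates multiplies the norm by 4, and it is onto because `mod-4` makes every
  -- representation of a multiple of 4 even.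
  reps₃-4n : ∀ n → length (reps₃ (n ℕ.* 4)) ≡ length (reps₃ n)
  reps₃-4n n = sym (bijection-length {xs = reps₃ n} {reps₃ (n ℕ.* 4)} double double-injective (unique enumerates₃ n)
    (unique enumerates₃ (n ℕ.* 4))
    (λ {x} x∈ → subst (λ k → double x ∈ reps₃ k)
      (trans (norm₃-double x) (cong (ℕ._* 4) (sound enumerates₃ {n = n} x∈))) (complete enumerates₃ (double x)))
    halve)
    where
    halve : ∀ {y} → y ∈ reps₃ (n ℕ.* 4) → ∃ λ x → x ∈ reps₃ n × y ≡ double x
    halve {y@(a , b , c)} y∈ =
      let norm-y = sound enumerates₃ {n = n ℕ.* 4} y∈
          2∣a , 2∣b , 2∣c = mod-4 (residue-of 4 a) (residue-of 4 b) (residue-of 4 c)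
            (trans (sym (norm₃-squares 4 a b c)) (trans (cong (ℕ._% 4) norm-y) (ℕ.m*n%n≡0 n 4)))
          a′ , p = even-residue a 2∣a
          b′ , q = even-residue b 2∣b
          c′ , r = even-residue c 2∣c
          x = a′ , b′ , c′
          y≡ = cong₂ _,_ p (cong₂ _,_ q r)
      in x , subst (λ k → x ∈ reps₃ k)
               (ℕ.*-cancelʳ-≡ (norm₃ x) n 4 (trans (sym (norm₃-double x)) (trans (cong norm₃ (sym y≡)) norm-y)))
                 (complete enumerates₃ x)
           , y≡

  4^-suc : ∀ α n → 4 ℕ.^ suc α ℕ.* n ≡ 4 ℕ.^ α ℕ.* n ℕ.* 4
  4^-suc α n = trans (ℕ.*-assoc 4 (4 ℕ.^ α) n) (ℕ.*-comm 4 (4 ℕ.^ α ℕ.* n))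

  reps₃-4^ : ∀ α n → length (reps₃ (4 ℕ.^ α ℕ.* n)) ≡ length (reps₃ n)
  reps₃-4^ zero n = cong (length ∘ reps₃) (ℕ.*-identityˡ n)
  reps₃-4^ (suc α) n = trans (cong (length ∘ reps₃) (4^-suc α n)) (trans (reps₃-4n (4 ℕ.^ α ℕ.* n)) (reps₃-4^ α n))

  -1^≡sign : ∀ n → (ℤ.- + 1) ℤ.^ n ≡ sign n
  -1^≡sign zero = refl
  -1^≡sign (suc n) = trans (ℤ.-1*i≡-i _) (cong ℤ.-_ (-1^≡sign n))

-- The two congruences

open GaussTheta using (sign)
open Frobenius
open SumsOfSquares using (reps₃; sign-*-self)
open Overpartitions
open import Data.Nat using (ℕ)
open import Data.Integer using (ℤ; +_; -_; _-_; _^_; _*_)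
open import Data.Integer.Divisibility using (_∣_)
open import Data.Product using (_×_)

theorem4p3 : (α n : ℕ) →
    (+ 7 ∣ (+ pbar3 (7 Data.Nat.* 4 Data.Nat.^ (α Data.Nat.+ 1) Data.Nat.* n) - (- + 1) ^ n * + pbar3 (7 Data.Nat.* n)))
    × (+ 7 ∣ + pbar3 (4 Data.Nat.^ α Data.Nat.* (56 Data.Nat.* n Data.Nat.+ 49)))
theorem4p3 α n =
    ∣⇒∣ᵤ (7∣- (≡₇-trans left (≡₇-sym right)))
  , ∣⇒∣ᵤ (subst (+ 7 ℤ.∣_) (ℤ.+-identityʳ (+ pbar3 (4 ℕ.^ α ℕ.* (56 ℕ.* n ℕ.+ 49)))) (7∣- vanishing))
  where
  r : ℕ
  r = length (reps₃ n)
  -- After division by 7 the index is a multiple of 4, so its sign is +1 and the powers of 4 drop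
  -- out of r₃.
  left : + pbar3 (7 ℕ.* 4 ℕ.^ (α ℕ.+ 1) ℕ.* n) ≡₇ + r
  left = ≡₇-trans (≡₇-reflexive (cong (+_ ∘ pbar3) index)) (≡₇-trans (pbar3-section (4 ℕ.^ suc α ℕ.* n)) (≡₇-reflexive
    (trans (cong₂ (λ s k → s ℤ.* + k) (trans (cong sign (4^-suc α n)) (sign-*4 (4 ℕ.^ α ℕ.* n))) (reps₃-4^ (suc α) n))
      (ℤ.*-identityˡ (+ r)))))
    where
    index : 7 ℕ.* 4 ℕ.^ (α ℕ.+ 1) ℕ.* n ≡ 4 ℕ.^ suc α ℕ.* n ℕ.* 7
    index = trans (cong (λ k → 7 ℕ.* 4 ℕ.^ k ℕ.* n) (ℕ.+-comm α 1))
      (trans (ℕ.*-assoc 7 (4 ℕ.^ suc α) n) (ℕ.*-comm 7 (4 ℕ.^ suc α ℕ.* n)))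
  -- The explicit (-1)ⁿ cancels the sign that `pbar3-section` attaches to r₃(n).
  right : (ℤ.- + 1) ℤ.^ n ℤ.* + pbar3 (7 ℕ.* n) ≡₇ + r
  right = ≡₇-trans (*-cong₇ (≡₇-reflexive (-1^≡sign n))
    (≡₇-trans (≡₇-reflexive (cong (+_ ∘ pbar3) (ℕ.*-comm 7 n))) (pbar3-section n)))
    (≡₇-reflexive (trans (sym (ℤ.*-assoc (sign n) (sign n) (+ r)))
      (trans (cong (ℤ._* + r) (sign-*-self n)) (ℤ.*-identityˡ (+ r)))))
  vanishing : + pbar3 (4 ℕ.^ α ℕ.* (56 ℕ.* n ℕ.+ 49)) ≡₇ + 0
  vanishing = ≡₇-trans (≡₇-reflexive (cong (+_ ∘ pbar3) index)) (≡₇-trans (pbar3-section m) (≡₇-reflexive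
    (trans (cong (λ k → sign m ℤ.* + k) (trans (reps₃-4^ α (8 ℕ.* n ℕ.+ 7)) (reps₃-8n+7 n))) (ℤ.*-zeroʳ (sign m)))))
    where
    m : ℕ
    m = 4 ℕ.^ α ℕ.* (8 ℕ.* n ℕ.+ 7)
    -- The constants are chosen so that 56n + 49 = 7(8n + 7), and 8n + 7 is never a sum of three
    -- squares.
    index : 4 ℕ.^ α ℕ.* (56 ℕ.* n ℕ.+ 49) ≡ m ℕ.* 7
    index = ℕS.solve 2 (λ k n → k :* (con 56 :* n :+ con 49) := k :* (con 8 :* n :+ con 7) :* con 7) refl (4 ℕ.^ α) n
      where open ℕS
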